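{- Let $K$ be a field with a non-Archimedean valuation $\mathrm{val}:K\to\mathbb{T}$. Let $Q$ be a finite quiver with vertex set $V=\{1,\dots,k\}$, arrows $A_Q$ and source/target maps $s,t$, and let $R$ be a $Q$-representation over $K$ assigning $K^n$ to each vertex and a weakly monomial matrix $A^{\alpha}\in K^{n\times n}$ to each arrow $\alpha$. Let $\mathbf{d}=(d_1,\dots,d_k)$ and let $\boldsymbol\mu=(\mu_1,\dots,\mu_k)$ with $\mu_i$ a valuated matroid of rank $d_i$ on $[n]$. Then $\boldsymbol\mu\in\operatorname{QDr}(R,\mathbf{d};n)$ (equivalently, $\mathrm{val}(A^{\alpha})\odot\overline{\operatorname{trop}}(\mu_{s(\alpha)})\subseteq\overline{\operatorname{trop}}(\mu_{t(\alpha)})$ for all arrows $\alpha$) if and only if for each arrow $\alpha$ the map $f_\alpha$ associated to $A^{\alpha}$ is an affine morphism of valuated matroids $f_\alpha:\mu_{t(\alpha)}\to\mu_{s(\alpha)}$, i.e. $f_\alpha^{ -1}(\mu_{s(\alpha)})$ is a valuated matroid quotient of $(\mu_{t(\alpha)})_o$.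
   Context: Notation: $\mathbb{T}=\mathbb{R}\cup\{\infty\}$, $\oplus=\min$, $\odot=+$; $\mathbb{P}(\mathbb{T}^N)=(\mathbb{T}^N\setminus\{(\infty,\ldots,\infty)\})/\mathbb{R}(1,\dots,1)$. A valuated matroid of rank $r$ on a finite set $E$ is $\nu:\binom{E}{r}\to\mathbb{T}$, not identically $\infty$, such that for all $I,J\in\binom{E}{r}$, $i\in I\setminus J$ there is $j\in J\setminus I$ with $\nu(I)+\nu(J)\ge\nu((I\setminus i)\cup j)+\nu((J\setminus j)\cup i)$ (up to adding a constant). Its tropical linear space $\overline{\operatorname{trop}}(\nu)\subseteq\mathbb{P}(\mathbb{T}^E)$ is the set of $x$ with $\min_i(C_i+x_i)$ attained at least twice (or $=\infty$) for every valuated circuit $C$, where the valuated circuits are the vectors $C(I)$, $I\in\binom{E}{r+1}$, $C(I)_i=\nu(I\setminus i)$ for $i\in I$, $\infty$ otherwise, that are not identically $\infty$. For a matrix $A$, $(\mathrm{val}(A)\odot x)_i=\min_j(\mathrm{val}(A_{ij})+x_j)$. Quiver Dressian: $\operatorname{QDr}(R,\mathbf{d};n)\subseteq\prod_i\mathbb{P}(\mathbb{T}^{\binom{n}{d_i}})$ is the set of tuples on which the tropicalizations of the following polynomials attain their minimum at least twice: for each vertex $i$ the Grassmann–Plücker relations $\sum_{j\in J\setminus I}\mathrm{sign}(j;I,J)p^{(i)}_{I\cup j}p^{(i)}_{J\setminus j}$ ($I\in\binom{[n]}{d_i-1},J\in\binom{[n]}{d_i+1}$), and for each arrow $\alpha$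 the quiver Plücker relations $\sum_{j\in[n]\setminus I,\,i\in J}\mathrm{sign}(j;I,J)(A^\alpha)_{i,j}p^{(s(\alpha))}_{I\cup j}p^{(t(\alpha))}_{J\setminus i}$ ($I\in\binom{[n]}{d_{s(\alpha)}-1},J\in\binom{[n]}{d_{t(\alpha)}+1}$), with $\mathrm{sign}(j;I,J)=(-1)^{\#\{j'\in J:j<j'\}+\#\{i\in I:i>j\}}$ and tropicalization replacing coefficients by valuations, $+$ by $\min$ and products by sums. A matrix is weakly monomial if each row has at most one nonzero entry. The map associated to a weakly monomial $A\in K^{n\times n}$ is $f=(f_1,f_2):[n]\cup\{o\}\to([n]\cup\{o\})\times\mathbb{T}$ with $f(o)=(o,\infty)$, $f(i)=(o,\infty)$ if row $i$ of $A$ is zero, and $f(i)=(j,\mathrm{val}(A_{ij}))$ if $A_{ij}\neq0$. For a valuated matroid $\nu$ of rank $r$ on $[n]$, the pointed valuated matroid $\nu_o$ on $[n]\cup\{o\}$ has $\nu_o(B)=\nu(B)$ if $o\notin B$ and $\infty$ if $o\in B$ ($o$ is a loop). For $f=(f_1,f_2):[n]\cup\{o\}\to([n]\cup\{o\})\times\mathbb{T}$, let $S=f_1([n]\cup\{o\})$, $r'$ the rank of $S$ in the underlying matroid of $\nu_o$, and $\nu_o|_S$ the restriction of $\nu_o$ to $S$; the affine induced valuated matroid $f^{ -1}(\nu)$ on $[n]\cup\{o\}$ of rank $r'$ is $f^{ -1}(\nu)(B)=\nu_o|_S(f_1(B))+\sum_{i\in B}f_2(i)$ if $f_1$ is injective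 on $B$, and $\infty$ otherwise. For valuated matroids $\mu,\nu$ of ranks $r\le s$ on a common ground set, $\mu$ is a quotient of $\nu$ if for all $I\in\binom{E}{r}$, $J\in\binom{E}{s}$, $i\in I\setminus J$ there is $j\in J\setminus I$ with $\mu(I)+\nu(J)\ge\mu(I\cup j\setminus i)+\nu(J\cup i\setminus j)$. $f:\mu\to\nu$ is an affine morphism of valuated matroids if $f^{ -1}(\nu)$ is a quotient of $\mu_o$. -}

module Defs where

open import Level using (Level; _⊔_) renaming (suc to lsuc; zero to lzero)
open import Data.Nat as ℕ using (ℕ; zero; suc; _∸_; _≡ᵇ_)
open import Data.Bool using (Bool; true; false; _∧_; _∨_; if_then_else_; not)
open import Data.Fin as F using (Fin)
open import Data.Fin.Subset as Sub using (Subset; ∣_∣; _∈_; _∉_; _⊆_; _∪_; _─_; ⁅_⁆)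
open import Data.Vec as V using (Vec; []; _∷_)
open import Data.List as L using (List; []; _∷_)
import Data.Bool.ListAction as BL
open import Data.Maybe using (Maybe; just; nothing)
open import Data.Product using (Σ; Σ-syntax; _×_; _,_)
open import Data.Sum using (_⊎_)
open import Data.Empty using (⊥)
open import Relation.Nullary using (¬_; Dec; yes; no)
open import Relation.Nullary.Decidable using (⌊_⌋)
open import Relation.Binary.PropositionalEquality using (_≡_; _≢_)
open import Algebra.Bundles using (CommutativeRing)

-- The real numbers, given axiomatically as a (Dedekind-)complete
-- ordered field with decidable order (the classical real numbers).
-- Since every complete ordered field is isomorphic to ℝ, quantifying
-- over all models of this record is the same as speaking about ℝ.

record Reals : Set₁ where
  infixl 6 _+_
  infixl 7 _*_
  infix  4 _≤_
  field
    Carrier : Set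
    _+_ _*_ : Carrier → Carrier → Carrier
    -_      : Carrier → Carrier
    0ℝ 1ℝ   : Carrier
    _≤_     : Carrier → Carrier → Set
    _≤?_    : (x y : Carrier) → Dec (x ≤ y)
    +-assoc : ∀ x y z → (x + y) + z ≡ x + (y + z)
    +-comm  : ∀ x y → x + y ≡ y + x
    +-idˡ   : ∀ x → 0ℝ + x ≡ x
    +-invˡ  : ∀ x → (- x) + x ≡ 0ℝ
    *-assoc : ∀ x y z → (x * y) * z ≡ x * (y * z)
    *-comm  : ∀ x y → x * y ≡ y * x
    *-idˡ   : ∀ x → 1ℝ * x ≡ x
    *-inv   : ∀ x → x ≢ 0ℝ → Σ[ y ∈ Carrier ] y * x ≡ 1ℝ
    distrib : ∀ x y z → x * (y + z) ≡ (x * y) + (x * z)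
    0≢1     : 0ℝ ≢ 1ℝ
    ≤-refl    : ∀ x → x ≤ x
    ≤-trans   : ∀ {x y z} → x ≤ y → y ≤ z → x ≤ z
    ≤-antisym : ∀ {x y} → x ≤ y → y ≤ x → x ≡ y
    ≤-total   : ∀ x y → x ≤ y ⊎ y ≤ x
    +-mono  : ∀ {x y} z → x ≤ y → x + z ≤ y + z
    *-pos   : ∀ {x y} → 0ℝ ≤ x → 0ℝ ≤ y → 0ℝ ≤ x * y
    complete : (P : Carrier → Set) → Σ[ x ∈ Carrier ] P x →
               Σ[ b ∈ Carrier ] (∀ x → P x → x ≤ b) →
               Σ[ s ∈ Carrier ] ((∀ x → P x → x ≤ s) ×
                                 (∀ b → (∀ x → P x → x ≤ b) → s ≤ b))

record Field (c ℓ : Level) : Set (lsuc (c ⊔ ℓ)) where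
  field
    commutativeRing : CommutativeRing c ℓ
  open CommutativeRing commutativeRing public
  field
    0≉1     : ¬ (0# ≈ 1#)
    inverse : ∀ x → ¬ (x ≈ 0#) → Σ[ y ∈ Carrier ] (y * x ≈ 1#)

module Trop (ℝ : Reals) where
  private module R = Reals ℝ

  data 𝕋 : Set where
    fin : R.Carrier → 𝕋
    ∞   : 𝕋

  infix 4 _≤T_
  data _≤T_ : 𝕋 → 𝕋 → Set where
    fin≤fin : ∀ {x y} → x R.≤ y → fin x ≤T fin y
    _≤∞     : ∀ x → x ≤T ∞

  infixl 6 _⊙_
  _⊙_ : 𝕋 → 𝕋 → 𝕋
  fin x ⊙ fin y = fin (x R.+ y)
  fin x ⊙ ∞     = ∞
  ∞     ⊙ y     = ∞

  infixl 5 _⊕_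
  _⊕_ : 𝕋 → 𝕋 → 𝕋
  fin x ⊕ fin y with x R.≤? y
  ... | yes _ = fin x
  ... | no  _ = fin y
  fin x ⊕ ∞ = fin x
  ∞     ⊕ y = y

  isInf : 𝕋 → Bool
  isInf (fin _) = false
  isInf ∞       = true

  record Valuation {c ℓ} (K : Field c ℓ) : Set (c ⊔ ℓ) where
    open Field K
    field
      val      : Carrier → 𝕋
      val-cong : ∀ {x y} → x ≈ y → val x ≡ val y
      val-∞    : ∀ x → (val x ≡ ∞ → x ≈ 0#) × (x ≈ 0# → val x ≡ ∞)
      val-*    : ∀ x y → val (x * y) ≡ val x ⊙ val y
      val-+    : ∀ x y → val x ⊕ val y ≤T val (x + y)

  WeaklyMonomial : ∀ {c ℓ} (K : Field c ℓ) {n : ℕ} →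
                   (Fin n → Fin n → Field.Carrier K) → Set ℓ
  WeaklyMonomial K {n} A =
    ∀ (i j j' : Fin n) → ¬ (A i j ≈ 0#) → ¬ (A i j' ≈ 0#) → j ≡ j'
    where open Field K

  MinTwice : {X : Set} → (X → Set) → (X → 𝕋) → Set
  MinTwice {X} P t =
    (∀ x → P x → t x ≡ ∞) ⊎
    Σ[ x ∈ X ] Σ[ y ∈ X ] (P x × P y × x ≢ y × t x ≡ t y ×
                           (∀ z → P z → t x ≤T t z))

  -- Valuated matroids on [n] = Fin n. A vector in 𝕋^(n choose r) is
  -- represented by a function on all subsets; only its values on
  -- r-subsets are ever used.

  IsValuatedMatroid : (n r : ℕ) → (Subset n → 𝕋) → Set
  IsValuatedMatroid n r ν =
    (Σ[ B ∈ Subset n ] (∣ B ∣ ≡ r × ν B ≢ ∞)) ×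
    (∀ (I J : Subset n) → ∣ I ∣ ≡ r → ∣ J ∣ ≡ r →
       ∀ i → i ∈ I → i ∉ J →
       Σ[ j ∈ Fin n ] (j ∈ J × j ∉ I ×
         (ν ((I ─ ⁅ i ⁆) ∪ ⁅ j ⁆) ⊙ ν ((J ─ ⁅ j ⁆) ∪ ⁅ i ⁆) ≤T ν I ⊙ ν J)))

  IsQuotient : (m r s : ℕ) → (μ ν : Subset m → 𝕋) → Set
  IsQuotient m r s μ ν =
    r ℕ.≤ s ×
    (∀ (I J : Subset m) → ∣ I ∣ ≡ r → ∣ J ∣ ≡ s →
       ∀ i → i ∈ I → i ∉ J →
       Σ[ j ∈ Fin m ] (j ∈ J × j ∉ I ×
         (μ ((I ∪ ⁅ j ⁆) ─ ⁅ i ⁆) ⊙ ν ((J ∪ ⁅ i ⁆) ─ ⁅ j ⁆) ≤T μ I ⊙ ν J)))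

  -- The quiver Dressian. Tropicalization: coefficients ±1 have valuation
  -- 0, coefficient ±A_{ij} has valuation val(A_{ij}), + becomes min and
  -- products become sums (signs disappear).

  TropGP : (n d : ℕ) → (Subset n → 𝕋) → Set
  TropGP n d p =
    ∀ (I J : Subset n) → suc ∣ I ∣ ≡ d → ∣ J ∣ ≡ suc d →
    MinTwice (λ j → j ∈ J × j ∉ I)
             (λ j → p (I ∪ ⁅ j ⁆) ⊙ p (J ─ ⁅ j ⁆))

  TropQP : (n ds dt : ℕ) → (Fin n → Fin n → 𝕋) →
           (Subset n → 𝕋) → (Subset n → 𝕋) → Set
  TropQP n ds dt W p q =
    ∀ (I J : Subset n) → suc ∣ I ∣ ≡ ds → ∣ J ∣ ≡ suc dt →
    MinTwice (λ (ij : Fin n × Fin n) → let (i , j) = ij in j ∉ I × i ∈ J)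
             (λ ij → let (i , j) = ij in
                     W i j ⊙ p (I ∪ ⁅ j ⁆) ⊙ q (J ─ ⁅ i ⁆))

  InQDr : (n k a : ℕ) (s t : Fin a → Fin k)
          (W : Fin a → Fin n → Fin n → 𝕋) (d : Fin k → ℕ)
          (p : Fin k → Subset n → 𝕋) → Set
  InQDr n k a s t W d p =
    (∀ v → TropGP n (d v) (p v)) ×
    (∀ α → TropQP n (d (s α)) (d (t α)) (W α) (p (s α)) (p (t α)))

  -- Ground set [n] ∪ {o} is Fin (suc n), with o = zero and i ↦ suc i.

  pointed : ∀ {n} → (Subset n → 𝕋) → Subset (suc n) → 𝕋
  pointed ν (true  ∷ B) = ∞
  pointed ν (false ∷ B) = ν B

  private
    findFin : ∀ {n} → (Fin n → Bool) → Maybe (Fin n)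
    findFin {zero}  P = nothing
    findFin {suc n} P with P F.zero
    ... | true  = just F.zero
    ... | false with findFin (λ i → P (F.suc i))
    ...   | just i  = just (F.suc i)
    ...   | nothing = nothing

    anyFin : ∀ {n} → (Fin n → Bool) → Bool
    anyFin P = BL.any P (L.allFin _)

    allFinᵇ : ∀ {n} → (Fin n → Bool) → Bool
    allFinᵇ P = BL.all P (L.allFin _)

    ∈ᵇ : ∀ {n} → Fin n → Subset n → Bool
    ∈ᵇ i B = V.lookup B i

    eqᵇ : ∀ {n} → Fin n → Fin n → Bool
    eqᵇ i j = ⌊ i F.≟ j ⌋

    subsets : ∀ m → List (Subset m)
    subsets zero    = [] ∷ []
    subsets (suc m) = L.map (true ∷_) (subsets m) L.++ L.map (false ∷_) (subsets m)

    minList : List 𝕋 → 𝕋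
    minList = L.foldr _⊕_ ∞

  -- The map f = (f₁ , f₂) associated to a (weakly monomial) matrix, given
  -- through its entrywise valuation W = val(A): f(i) = (j, W i j) for the
  -- (unique) j with A_{ij} ≠ 0, i.e. W i j ≠ ∞; f(i) = (o, ∞) if row i is
  -- zero; f(o) = (o, ∞).
  assocMap₁ : ∀ {n} → (Fin n → Fin n → 𝕋) → Fin (suc n) → Fin (suc n)
  assocMap₁ W F.zero    = F.zero
  assocMap₁ W (F.suc i) with findFin (λ j → not (isInf (W i j)))
  ... | just j  = F.suc j
  ... | nothing = F.zero

  assocMap₂ : ∀ {n} → (Fin n → Fin n → 𝕋) → Fin (suc n) → 𝕋
  assocMap₂ W F.zero    = ∞
  assocMap₂ W (F.suc i) with findFin (λ j → not (isInf (W i j)))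
  ... | just j  = W i j
  ... | nothing = ∞

  image : ∀ {m} → (Fin m → Fin m) → Subset m → Subset m
  image f B = V.tabulate (λ y → anyFin (λ x → ∈ᵇ x B ∧ eqᵇ (f x) y))

  Independent : (m r : ℕ) → (Subset m → 𝕋) → Subset m → Set
  Independent m r ν B = Σ[ C ∈ Subset m ] (∣ C ∣ ≡ r × B ⊆ C × ν C ≢ ∞)

  IsRank : (m r : ℕ) → (Subset m → 𝕋) → Subset m → ℕ → Set
  IsRank m r ν S r' =
    (Σ[ B ∈ Subset m ] (B ⊆ S × ∣ B ∣ ≡ r' × Independent m r ν B)) ×
    (∀ B → B ⊆ S → Independent m r ν B → ∣ B ∣ ℕ.≤ r')

  -- restriction ν|_S (ν of rank r, S of rank r'):
  -- ν|_S(B) = min { ν(B ∪ J) : J ⊆ complement of S, |J| = r - r' }.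
  -- (Any single admissible J gives the same valuated matroid up to an
  -- additive constant; the minimum is a canonical representative.)
  restriction : (m r r' : ℕ) → (Subset m → 𝕋) → Subset m → Subset m → 𝕋
  restriction m r r' ν S B =
    minList (L.map (λ J → ν (B ∪ J))
                   (L.filterᵇ (λ J → (∣ J ∣ ≡ᵇ (r ∸ r')) ∧
                                      not (anyFin (λ x → ∈ᵇ x J ∧ ∈ᵇ x S)))
                             (subsets m)))

  induced : (n r r' : ℕ) → (Fin n → Fin n → 𝕋) → (Subset n → 𝕋) →
            Subset (suc n) → 𝕋
  induced n r r' W ν B =
    if injOn then restriction (suc n) r r' (pointed ν) S (image f₁ B) ⊙ sumf₂
    else ∞
    where
    f₁ = assocMap₁ W
    f₂ = assocMap₂ W
    S  = image f₁ Sub.⊤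
    injOn = allFinᵇ (λ x → allFinᵇ (λ y →
              not (∈ᵇ x B ∧ ∈ᵇ y B ∧ eqᵇ (f₁ x) (f₁ y)) ∨ eqᵇ x y))
    sumf₂ = L.foldr (λ x acc → if ∈ᵇ x B then f₂ x ⊙ acc else acc)
                    (fin R.0ℝ) (L.allFin (suc n))

  IsAffineMorphism : (n rμ rν : ℕ) → (Fin n → Fin n → 𝕋) →
                     (μ ν : Subset n → 𝕋) → Set
  IsAffineMorphism n rμ rν W μ ν =
    ∀ r' → IsRank (suc n) rν (pointed ν) (image (assocMap₁ W) Sub.⊤) r' →
    IsQuotient (suc n) r' rμ (induced n rν r' W ν) (pointed μ)

{-# OPTIONS --safe #-}
module Submission where

open import Defs
open import Level using (Level; 0ℓ)
open import Algebra.Bundles using (CommutativeMonoid)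
open import Data.Bool using (Bool; true; false; if_then_else_; T; T?; not; _∧_; _∨_)
import Data.Bool.ListAction as BL
open import Data.Bool.Properties using (T-∧; T-≡; T-not-≡)
open import Data.Empty using (⊥-elim) renaming (⊥ to Empty)
open import Data.Fin using (Fin; zero; suc; _≟_)
open import Data.Fin.Subset using (Subset; ∣_∣; _∈_; _∉_; _⊆_; _∪_; _∩_; _─_; _-_; ⁅_⁆; ⊥; ⊤)
open import Data.Fin.Subset.Properties
open import Data.List using (List; []; _∷_; foldr; allFin; map; filterᵇ; cartesianProduct)
open import Data.List.Membership.Propositional using () renaming (_∈_ to _∈ᴸ_; find to findᴸ; lose to loseᴸ)
import Data.List.Membership.Propositional.Properties as ∈ᴸ
open import Data.List.Relation.Unary.All as All using (All)
import Data.List.Relation.Unary.All.Properties as All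
open import Data.List.Relation.Unary.AllPairs using ([]; _∷_)
open import Data.List.Relation.Unary.Any using (here; there)
import Data.List.Relation.Unary.Any.Properties as Any
open import Data.List.Relation.Unary.Unique.Propositional using (Unique)
open import Data.List.Relation.Unary.Unique.Propositional.Properties using (allFin⁺)
open import Data.Maybe using (Maybe; just; nothing)
open import Data.Nat as ℕ using (ℕ; zero; suc; _∸_; _≡ᵇ_)
import Data.Nat.Properties as ℕₚ
open import Data.Product using (Σ-syntax; _×_; _,_; proj₁; proj₂)
open import Data.Product.Properties using (≡-dec)
open import Data.Sum using (_⊎_; inj₁; inj₂; [_,_]′)
open import Data.Unit using (tt)
open import Data.Vec using ([]; _∷_; here; there; lookup)
open import Data.Vec.Properties using (lookup∘tabulate; []=⇒lookup; lookup⇒[]=)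
open import Function using (_∘_; id; Equivalence)
open import Relation.Binary.PropositionalEquality
open import Relation.Nullary using (¬_; Dec; yes; no; contradiction)
open import Relation.Nullary.Decidable using (_×-dec_; ¬?; ⌊_⌋; toWitness; fromWitness)
open import Tactic.Cong using (cong!)
open Equivalence using (to; from)

-- Since A is weakly monomial, a quiver Plücker relation is indexed by i alone: its
-- terms are f₂(i) + p(I ∪ f₁(i)) + q(J ∖ i).  For finite f⁻¹(p)(A ∪ i) = p(f₁(A ∪ i) ∪ L) + Σ f₂,
-- the quotient exchange between A ∪ i and J is the Plücker relation for
-- I = f₁(A) ∪ L and J ∪ i with the common summand Σ f₂ over A removed.
--
-- Conversely the quotient axiom only yields the relations whose I meets the image S
-- of f₁ in a set of corank one.  For arbitrary I and fixed s = f₁(i), one replaces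
-- elements of I outside S by elements of S, minimising p(K ∪ c ∪ s) − p(K ∪ e ∪ c) over c ∈ S
-- where I = K ∪ e.  A single exchange shows that the vector p(I ∪ ·) is dominated on S by a
-- translate of the new one, with equality at s; hence the relation for the new set
-- implies the one for I.

-- Finite subsets

-- The restriction inside `induced` is a minimum over all completions L, and the completions that
-- attain it at A ∪ i and at A ∪ j may differ. From Plücker relations to quotients this is harmless,
-- because the completion found for A ∪ i still bounds the value at A ∪ j from above. In the
-- converse direction the completion attaining the value at A ∪ j has to be traded for the part of I
-- outside S. Corank one makes this possible: an exchange that removed an element of the completion
-- instead would produce a finite basis with more than r′ elements in S. The value ∞ forbids
-- subtraction. Differences are therefore compared crosswise, each cancellation needs a finite
-- summand, and the relations and exchange axioms are restated for finite values only. The rank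
-- inequality in the definition of a quotient does not come with an exchange axiom and is derived by
-- a descent.

private variable
  m : ℕ
  X Y : Subset m
  x y : Fin m

infixl 6 _⊹_
_⊹_ : Subset m → Fin m → Subset m
X ⊹ x = X ∪ ⁅ x ⁆

∈⊹⁻ : x ∈ X ⊹ y → x ∈ X ⊎ x ≡ y
∈⊹⁻ {X = X} {y = y} h with x∈p∪q⁻ X ⁅ y ⁆ h
... | inj₁ p = inj₁ p
... | inj₂ q = inj₂ (x∈⁅y⁆⇒x≡y y q)

∈⊹ˡ : x ∈ X → x ∈ X ⊹ y
∈⊹ˡ h = x∈p∪q⁺ (inj₁ h)

∈⊹ʳ : y ∈ X ⊹ y
∈⊹ʳ {y = y} {X = X} = x∈p∪q⁺ {p = X} (inj₂ (x∈⁅x⁆ y))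

∈⊹-≢ : x ∈ X ⊹ y → x ≢ y → x ∈ X
∈⊹-≢ h x≢y = [ id , (λ e → contradiction e x≢y) ]′ (∈⊹⁻ h)

∉⊹ : x ∉ X → x ≢ y → x ∉ X ⊹ y
∉⊹ x∉X x≢y h = x∉X (∈⊹-≢ h x≢y)

∈─⁻ : ∀ (X Y : Subset m) → x ∈ X ─ Y → x ∉ Y
∈─⁻ (_ ∷ X) (true  ∷ Y) (there h) (there k) = ∈─⁻ X Y h k
∈─⁻ (_ ∷ X) (false ∷ Y) (there h) (there k) = ∈─⁻ X Y h k

∈-⇒∈ : x ∈ X - y → x ∈ X
∈-⇒∈ {X = X} {y = y} = p─q⊆p X ⁅ y ⁆

∈-⇒≢ : x ∈ X - y → x ≢ y
∈-⇒≢ {X = X} {y = y} h refl = ∈─⁻ X ⁅ y ⁆ h (x∈⁅x⁆ y)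

⊹-remove : x ∈ X → (X - x) ⊹ x ≡ X
⊹-remove {x = x} {X = X} x∈X = ⊆-antisym
  (λ h → [ ∈-⇒∈ , (λ { refl → x∈X }) ]′ (∈⊹⁻ h))
  λ {y} h → [ (λ { refl → ∈⊹ʳ {X = X - x} }) , (λ y≢x → ∈⊹ˡ (x∈p∧x≢y⇒x∈p-y h y≢x)) ]′ (dec (y ≟ x))
  where
  dec : ∀ {P : Set} → Dec P → P ⊎ ¬ P
  dec (yes p) = inj₁ p
  dec (no ¬p) = inj₂ ¬p

remove-⊹ : x ∉ X → (X ⊹ x) - x ≡ X
remove-⊹ x∉X = ⊆-antisym
  (λ h → ∈⊹-≢ (∈-⇒∈ h) (∈-⇒≢ h))
  (λ h → x∈p∧x≢y⇒x∈p-y (∈⊹ˡ h) λ { refl → x∉X h })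

⊹-comm : ∀ (X : Subset m) x y → (X ⊹ x) ⊹ y ≡ (X ⊹ y) ⊹ x
⊹-comm X x y = trans (∪-assoc X _ _) (trans (cong (X ∪_) (∪-comm ⁅ x ⁆ ⁅ y ⁆)) (sym (∪-assoc X _ _)))

⊹-∪ : ∀ (X L : Subset m) x → (X ∪ L) ⊹ x ≡ (X ⊹ x) ∪ L
⊹-∪ X L x = trans (∪-assoc X _ _) (trans (cong (X ∪_) (∪-comm L ⁅ x ⁆)) (sym (∪-assoc X _ _)))

⊹-remove-≢ : x ≢ y → (X ⊹ x) - y ≡ (X - y) ⊹ x
⊹-remove-≢ x≢y = ⊆-antisym
  (λ h → [ (λ k → ∈⊹ˡ (x∈p∧x≢y⇒x∈p-y k (∈-⇒≢ h))) , (λ { refl → ∈⊹ʳ }) ]′ (∈⊹⁻ (∈-⇒∈ h)))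
  (λ h → [ (λ k → x∈p∧x≢y⇒x∈p-y (∈⊹ˡ (∈-⇒∈ k)) (∈-⇒≢ k)) , (λ { refl → x∈p∧x≢y⇒x∈p-y ∈⊹ʳ x≢y }) ]′ (∈⊹⁻ h))

∣⊹∣ : x ∉ X → ∣ X ⊹ x ∣ ≡ suc ∣ X ∣
∣⊹∣ {x = zero}  {X = true  ∷ X} x∉ = contradiction here x∉
∣⊹∣ {x = zero}  {X = false ∷ X} x∉ = cong (suc ∘ ∣_∣) (∪-identityʳ X)
∣⊹∣ {x = suc x} {X = true  ∷ X} x∉ = cong suc (∣⊹∣ (x∉ ∘ there))
∣⊹∣ {x = suc x} {X = false ∷ X} x∉ = ∣⊹∣ (x∉ ∘ there)

∣remove∣ : x ∈ X → suc ∣ X - x ∣ ≡ ∣ X ∣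
∣remove∣ {x = x} {X = X} x∈X =
  trans (sym (∣⊹∣ {x = x} {X = X - x} (λ h → ∈-⇒≢ {X = X} h refl))) (cong ∣_∣ (⊹-remove x∈X))

∣∪∣ : ∀ {X L : Subset m} → (∀ {x} → x ∈ X → x ∉ L) → ∣ X ∪ L ∣ ≡ ∣ X ∣ ℕ.+ ∣ L ∣
∣∪∣ {X = []}        {[]}        _ = refl
∣∪∣ {X = true ∷ X}  {true ∷ L}  d = contradiction here (d here)
∣∪∣ {X = true ∷ X}  {false ∷ L} d = cong suc (∣∪∣ λ p q → d (there p) (there q))
∣∪∣ {X = false ∷ X} {true ∷ L}  d =
  trans (cong suc (∣∪∣ λ p q → d (there p) (there q))) (sym (ℕₚ.+-suc ∣ X ∣ ∣ L ∣))
∣∪∣ {X = false ∷ X} {false ∷ L} d = ∣∪∣ λ p q → d (there p) (there q)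

∩∪─ : ∀ (X S : Subset m) → (X ∩ S) ∪ (X ─ S) ≡ X
∩∪─ [] [] = refl
∩∪─ (true  ∷ X) (true  ∷ S) = cong (true  ∷_) (∩∪─ X S)
∩∪─ (true  ∷ X) (false ∷ S) = cong (true  ∷_) (∩∪─ X S)
∩∪─ (false ∷ X) (true  ∷ S) = cong (false ∷_) (∩∪─ X S)
∩∪─ (false ∷ X) (false ∷ S) = cong (false ∷_) (∩∪─ X S)

∣∩∣+∣─∣ : ∀ (X S : Subset m) → ∣ X ∩ S ∣ ℕ.+ ∣ X ─ S ∣ ≡ ∣ X ∣
∣∩∣+∣─∣ X S = trans (sym (∣∪∣ λ p q → ∈─⁻ X S q (proj₂ (x∈p∩q⁻ X S p)))) (cong ∣_∣ (∩∪─ X S))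

⊹-∩-∈ : ∀ {X S : Subset m} {y} → y ∈ S → (X ⊹ y) ∩ S ≡ (X ∩ S) ⊹ y
⊹-∩-∈ {X = X} {S} {y} y∈S = ⊆-antisym
  (λ h → let k , s = x∈p∩q⁻ _ S h in [ (λ p → ∈⊹ˡ (x∈p∩q⁺ (p , s))) , (λ { refl → ∈⊹ʳ }) ]′ (∈⊹⁻ k))
  (λ h → [ (λ k → let p , s = x∈p∩q⁻ X S k in x∈p∩q⁺ (∈⊹ˡ p , s))
         , (λ { refl → x∈p∩q⁺ (∈⊹ʳ , y∈S) }) ]′ (∈⊹⁻ h))

remove-∩-∉ : ∀ {X S : Subset m} {y} → y ∉ S → (X - y) ∩ S ≡ X ∩ S
remove-∩-∉ {X = X} {S} {y} y∉S = ⊆-antisym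
  (λ h → let k , s = x∈p∩q⁻ _ S h in x∈p∩q⁺ (∈-⇒∈ k , s))
  (λ h → let k , s = x∈p∩q⁻ X S h in x∈p∩q⁺ (x∈p∧x≢y⇒x∈p-y k (λ { refl → y∉S s }) , s))

∣Y∣<∣X∣⇒∃∈∖ : ∀ (X Y : Subset m) → ∣ Y ∣ ℕ.< ∣ X ∣ → Σ[ x ∈ Fin m ] x ∈ X × x ∉ Y
∣Y∣<∣X∣⇒∃∈∖ (true  ∷ X) (false ∷ Y) _ = zero , here , λ ()
∣Y∣<∣X∣⇒∃∈∖ (true  ∷ X) (true  ∷ Y) (ℕ.s≤s h) =
  let x , p , q = ∣Y∣<∣X∣⇒∃∈∖ X Y h in suc x , there p , λ { (there k) → q k }
∣Y∣<∣X∣⇒∃∈∖ (false ∷ X) (true  ∷ Y) h =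
  let x , p , q = ∣Y∣<∣X∣⇒∃∈∖ X Y (ℕₚ.<-trans (ℕₚ.n<1+n _) h) in suc x , there p , λ { (there k) → q k }
∣Y∣<∣X∣⇒∃∈∖ (false ∷ X) (false ∷ Y) h =
  let x , p , q = ∣Y∣<∣X∣⇒∃∈∖ X Y h in suc x , there p , λ { (there k) → q k }

-- The quotient axiom demands a witness even when its right-hand side is `∞`. Counting supplies one,
-- and this is where the rank inequality enters.
exchange-candidate : ∣ X ∣ ℕ.≤ ∣ Y ∣ → x ∈ X → x ∉ Y → Σ[ y ∈ Fin _ ] y ∈ Y × y ∉ X
exchange-candidate {X = X} {Y = Y} {x = x} X≤Y x∈X x∉Y =
  let y , y∈Y , y∉ = ∣Y∣<∣X∣⇒∃∈∖ Y (X - x) (ℕₚ.≤-trans (ℕₚ.≤-reflexive (∣remove∣ x∈X)) X≤Y)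
  in y , y∈Y , λ y∈X → y∉ (x∈p∧x≢y⇒x∈p-y y∈X λ y≡x → x∉Y (subst (_∈ Y) y≡x y∈Y))

subset-induction : (P : Subset m → Set) → P ⊥ → (∀ X x → x ∉ X → P X → P (X ⊹ x)) → ∀ X → P X
subset-induction P base step [] = base
subset-induction {suc m} P base step (b ∷ X) = head b
  where
  tail : P (false ∷ X)
  tail = subset-induction (P ∘ (false ∷_)) base
    (λ Y y y∉ → step (false ∷ Y) (suc y) λ { (there h) → y∉ h }) X
  head : ∀ b → P (b ∷ X)
  head false = tail
  head true  = subst (P ∘ (true ∷_)) (∪-identityʳ X) (step (false ∷ X) zero (λ ()) tail)

-- Transitivity is asked only among points satisfying `P`, because the relation minimised in
-- `replace` may fail to be transitive when infinite values are allowed.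
extremum : {A : Set} {P : A → Set} (P? : ∀ x → Dec (P x)) (R : A → A → Set) →
  (∀ x y → R x y ⊎ R y x) → (∀ {x y z} → P x → P y → P z → R x y → R y z → R x z) → ∀ xs →
  (∀ x → x ∈ᴸ xs → ¬ P x) ⊎ Σ[ x ∈ A ] (P x × (∀ y → y ∈ᴸ xs → P y → R x y))
extremum P? R total tr [] = inj₁ λ _ ()
extremum {A} {P} P? R total tr (a ∷ xs) with P? a | extremum P? R total tr xs
... | no ¬Pa | inj₁ none = inj₁ λ { _ (here refl) → ¬Pa ; x (there h) → none x h }
... | no ¬Pa | inj₂ (x , Px , min) =
  inj₂ (x , Px , λ { _ (here refl) Py → contradiction Py ¬Pa ; y (there h) → min y h })
... | yes Pa | inj₁ none =
  inj₂ (a , Pa , λ { _ (here refl) _ → [ id , id ]′ (total a a) ; y (there h) Py → contradiction Py (none y h) })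
... | yes Pa | inj₂ (x , Px , min) with total x a
...   | inj₁ Rxa = inj₂ (x , Px , λ { _ (here refl) _ → Rxa ; y (there h) → min y h })
...   | inj₂ Rax = inj₂ (a , Pa , λ { _ (here refl) _ → [ id , id ]′ (total a a)
                                    ; y (there h) Py → tr Pa Px Py Rax (min y h Py) })

-- Injectivity on subsets and Boolean quantifiers

InjOn : (Fin m → Fin m) → Subset m → Set
InjOn f B = ∀ {x y} → x ∈ B → y ∈ B → f x ≡ f y → x ≡ y

∈⇒T : x ∈ X → T (lookup X x)
∈⇒T h = from T-≡ ([]=⇒lookup h)

T⇒∈ : ∀ x → T (lookup X x) → x ∈ X
T⇒∈ {X = X} x t = lookup⇒[]= x X (to T-≡ t)

any-allFin⁺ : ∀ (p : Fin m → Bool) x → T (p x) → T (BL.any p (allFin m))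
any-allFin⁺ p x t = Any.any⁺ p (loseᴸ (∈ᴸ.∈-allFin x) t)

any-allFin⁻ : ∀ (p : Fin m → Bool) → T (BL.any p (allFin m)) → Σ[ x ∈ Fin m ] T (p x)
any-allFin⁻ p t = let x , _ , px = findᴸ (Any.any⁻ p (allFin _) t) in x , px

all-allFin⁺ : ∀ (p : Fin m → Bool) → (∀ x → T (p x)) → T (BL.all p (allFin m))
all-allFin⁺ p h = All.all⁻ p (All.universal h (allFin _))

all-allFin⁻ : ∀ (p : Fin m → Bool) → T (BL.all p (allFin m)) → ∀ x → T (p x)
all-allFin⁻ p t x = All.lookup (All.all⁺ p (allFin _) t) (∈ᴸ.∈-allFin x)

module Theory (ℝ : Reals) where
  open Trop ℝ
  private
    module R = Reals ℝ
    variable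
      a b c d : 𝕋

  -- Arithmetic and order of the tropical numbers

  ⊙-assoc : ∀ a b c → (a ⊙ b) ⊙ c ≡ a ⊙ (b ⊙ c)
  ⊙-assoc (fin x) (fin y) (fin z) = cong fin (R.+-assoc x y z)
  ⊙-assoc (fin x) (fin y) ∞ = refl
  ⊙-assoc (fin x) ∞ c = refl
  ⊙-assoc ∞ b c = refl

  ⊙-comm : ∀ a b → a ⊙ b ≡ b ⊙ a
  ⊙-comm (fin x) (fin y) = cong fin (R.+-comm x y)
  ⊙-comm (fin x) ∞ = refl
  ⊙-comm ∞ (fin y) = refl
  ⊙-comm ∞ ∞ = refl

  𝟘 : 𝕋
  𝟘 = fin R.0ℝ

  ⊙-identityˡ : ∀ a → 𝟘 ⊙ a ≡ a
  ⊙-identityˡ (fin x) = cong fin (R.+-idˡ x)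
  ⊙-identityˡ ∞ = refl

  ⊙-commutativeMonoid : CommutativeMonoid 0ℓ 0ℓ
  ⊙-commutativeMonoid = record
    { Carrier = 𝕋 ; _≈_ = _≡_ ; _∙_ = _⊙_ ; ε = 𝟘
    ; isCommutativeMonoid = record
      { isMonoid = record
        { isSemigroup = record
          { isMagma = record { isEquivalence = isEquivalence ; ∙-cong = cong₂ _⊙_ }
          ; assoc = ⊙-assoc }
        ; identity = ⊙-identityˡ , λ x → trans (⊙-comm x 𝟘) (⊙-identityˡ x) }
      ; comm = ⊙-comm } }

  open import Algebra.Solver.CommutativeMonoid ⊙-commutativeMonoid public
    using (solve; _⊜_) renaming (_⊕_ to _:⊙_)

  ⊙-∞ʳ : ∀ a → a ⊙ ∞ ≡ ∞
  ⊙-∞ʳ a = ⊙-comm a ∞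

  ≤T-refl : a ≤T a
  ≤T-refl {fin x} = fin≤fin (R.≤-refl x)
  ≤T-refl {∞} = ∞ ≤∞

  ≤T-reflexive : a ≡ b → a ≤T b
  ≤T-reflexive refl = ≤T-refl

  ≤T-trans : a ≤T b → b ≤T c → a ≤T c
  ≤T-trans (fin≤fin p) (fin≤fin q) = fin≤fin (R.≤-trans p q)
  ≤T-trans p (_ ≤∞) = _ ≤∞

  ≤T-total : ∀ a b → a ≤T b ⊎ b ≤T a
  ≤T-total (fin x) (fin y) with R.≤-total x y
  ... | inj₁ p = inj₁ (fin≤fin p)
  ... | inj₂ p = inj₂ (fin≤fin p)
  ≤T-total a ∞ = inj₁ (a ≤∞)
  ≤T-total ∞ b = inj₂ (b ≤∞)

  ≤T-antisym : a ≤T b → b ≤T a → a ≡ b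
  ≤T-antisym (fin≤fin p) (fin≤fin q) = cong fin (R.≤-antisym p q)
  ≤T-antisym (_ ≤∞) (_ ≤∞) = refl

  ⊙-monoˡ : ∀ c → a ≤T b → a ⊙ c ≤T b ⊙ c
  ⊙-monoˡ (fin z) (fin≤fin p) = fin≤fin (R.+-mono z p)
  ⊙-monoˡ ∞ (fin≤fin p) = ≤T-refl
  ⊙-monoˡ c (a ≤∞) = _ ≤∞

  ⊙-cancelʳ : c ≢ ∞ → a ⊙ c ≤T b ⊙ c → a ≤T b
  ⊙-cancelʳ {∞} c≢∞ p = contradiction refl c≢∞
  ⊙-cancelʳ {fin z} {a} {b} c≢∞ p =
    subst₂ _≤T_ (undo a) (undo b) (⊙-monoˡ (fin (R.- z)) p)
    where
    undo : ∀ a → (a ⊙ fin z) ⊙ fin (R.- z) ≡ a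
    undo a = trans (⊙-assoc a _ _)
      (trans (cong (λ w → a ⊙ fin w) (trans (R.+-comm z (R.- z)) (R.+-invˡ z)))
        (trans (⊙-comm a 𝟘) (⊙-identityˡ a)))

  infix 4 _≟∞
  _≟∞ : ∀ a → Dec (a ≡ ∞)
  fin x ≟∞ = no λ ()
  ∞ ≟∞ = yes refl

  ⊙-finiteˡ : ∀ a b → a ⊙ b ≢ ∞ → a ≢ ∞
  ⊙-finiteˡ a b h refl = h refl

  ⊙-finiteʳ : ∀ a b → a ⊙ b ≢ ∞ → b ≢ ∞
  ⊙-finiteʳ a b h refl = h (⊙-∞ʳ a)

  ⊙-finite : a ≢ ∞ → b ≢ ∞ → a ⊙ b ≢ ∞
  ⊙-finite {fin _} {fin _} _ _ ()
  ⊙-finite {fin _} {∞} _ h = contradiction refl h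
  ⊙-finite {∞} h _ = contradiction refl h

  ≤T-finite : a ≤T b → b ≢ ∞ → a ≢ ∞
  ≤T-finite (fin≤fin _) _ ()
  ≤T-finite (_ ≤∞) h = contradiction refl h

  ≤T-∞ : b ≡ ∞ → a ≤T b
  ≤T-∞ refl = _ ≤∞

  ⊕-≤ˡ : ∀ a b → a ⊕ b ≤T a
  ⊕-≤ˡ (fin x) (fin y) with x R.≤? y
  ... | yes _ = ≤T-refl
  ... | no ¬p = fin≤fin ([ (λ p → contradiction p ¬p) , id ]′ (R.≤-total x y))
  ⊕-≤ˡ (fin x) ∞ = ≤T-refl
  ⊕-≤ˡ ∞ b = _ ≤∞

  ⊕-≤ʳ : ∀ a b → a ⊕ b ≤T b
  ⊕-≤ʳ (fin x) (fin y) with x R.≤? y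
  ... | yes p = fin≤fin p
  ... | no _ = ≤T-refl
  ⊕-≤ʳ (fin x) ∞ = _ ≤∞
  ⊕-≤ʳ ∞ b = ≤T-refl

  ⊕-sel : ∀ a b → a ⊕ b ≡ a ⊎ a ⊕ b ≡ b
  ⊕-sel (fin x) (fin y) with x R.≤? y
  ... | yes _ = inj₁ refl
  ... | no _ = inj₂ refl
  ⊕-sel (fin x) ∞ = inj₁ refl
  ⊕-sel ∞ b = inj₂ refl

  ⨁ : List 𝕋 → 𝕋
  ⨁ = foldr _⊕_ ∞

  ⨁-≤ : ∀ {a} xs → a ∈ᴸ xs → ⨁ xs ≤T a
  ⨁-≤ (a ∷ xs) (here refl) = ⊕-≤ˡ a (⨁ xs)
  ⨁-≤ (x ∷ xs) (there h) = ≤T-trans (⊕-≤ʳ x (⨁ xs)) (⨁-≤ xs h)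

  ⨁-attained : ∀ xs → ⨁ xs ≢ ∞ → ⨁ xs ∈ᴸ xs
  ⨁-attained [] h = contradiction refl h
  ⨁-attained (x ∷ xs) h with ⊕-sel x (⨁ xs)
  ... | inj₁ e = here e
  ... | inj₂ e = there (subst (_∈ᴸ xs) (sym e) (⨁-attained xs (h ∘ trans e)))

  -- Without subtraction: a − x ≤ b − y and x − d ≤ y − c imply a − d ≤ b − c.
  cross-trans : ∀ {a b c d x y} → y ≢ ∞ → a ⊙ y ≤T x ⊙ b → x ⊙ c ≤T d ⊙ y → a ⊙ c ≤T d ⊙ b
  cross-trans {a} {b} {c} {d} {x} {y} y≢∞ p q = ⊙-cancelʳ y≢∞ (≤T-trans
    (≤T-reflexive (solve 3 (λ a c y → (a :⊙ c) :⊙ y ⊜ (a :⊙ y) :⊙ c) refl a c y))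
    (≤T-trans (⊙-monoˡ c p)
    (≤T-trans (≤T-reflexive (solve 3 (λ x b c → (x :⊙ b) :⊙ c ⊜ (x :⊙ c) :⊙ b) refl x b c))
    (≤T-trans (⊙-monoˡ b q)
      (≤T-reflexive (solve 3 (λ d y b → (d :⊙ y) :⊙ b ⊜ (d :⊙ b) :⊙ y) refl d y b))))))

  -- Images and the induced valuated matroid

  ∈-image⁺ : ∀ (f : Fin m → Fin m) → x ∈ X → f x ∈ image f X
  ∈-image⁺ {x = x} {X = X} f x∈X = T⇒∈ (f x) (subst T (sym (lookup∘tabulate _ (f x)))
    (any-allFin⁺ _ x (from T-∧ (∈⇒T x∈X , fromWitness refl))))

  ∈-image⁻ : ∀ (f : Fin m → Fin m) → y ∈ image f X → Σ[ x ∈ Fin m ] x ∈ X × f x ≡ y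
  ∈-image⁻ {y = y} {X = X} f h =
    let x , t = any-allFin⁻ _ (subst T (lookup∘tabulate _ y) (∈⇒T h))
        p , q = to T-∧ t
    in x , T⇒∈ x p , toWitness q

  image-⊹ : ∀ (f : Fin m → Fin m) X x → image f (X ⊹ x) ≡ image f X ⊹ f x
  image-⊹ f X x = ⊆-antisym
    (λ h → let z , z∈ , e = ∈-image⁻ {X = X ⊹ x} f h in
           [ (λ z∈X → ∈⊹ˡ (subst (_∈ image f X) e (∈-image⁺ f z∈X)))
           , (λ z≡x → subst (_∈ image f X ⊹ f x) (trans (cong f (sym z≡x)) e) (∈⊹ʳ {X = image f X})) ]′ (∈⊹⁻ {X = X} z∈))
    (λ h → [ (λ k → let z , z∈ , e = ∈-image⁻ {X = X} f k in
                    subst (_∈ image f (X ⊹ x)) e (∈-image⁺ {X = X ⊹ x} f (∈⊹ˡ z∈)))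
           , (λ { refl → ∈-image⁺ f (∈⊹ʳ {X = X}) }) ]′ (∈⊹⁻ {X = image f X} h))

  image-⊆ : ∀ (f : Fin m → Fin m) X → image f X ⊆ image f ⊤
  image-⊆ f X h = let z , _ , e = ∈-image⁻ {X = X} f h in subst (_∈ image f ⊤) e (∈-image⁺ f ∈⊤)

  image-⊥ : ∀ (f : Fin m → Fin m) → image f ⊥ ≡ ⊥
  image-⊥ f = ⊆-antisym (λ h → let _ , z∈ , _ = ∈-image⁻ {X = ⊥} f h in contradiction z∈ ∉⊥)
                        (λ h → contradiction h ∉⊥)

  InjOn-⊹ˡ : ∀ {f : Fin m → Fin m} → InjOn f (X ⊹ x) → InjOn f X
  InjOn-⊹ˡ {X = X} inj p q = inj (∈⊹ˡ {X = X} p) (∈⊹ˡ {X = X} q)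

  InjOn-∉ : ∀ {f : Fin m → Fin m} → InjOn f (X ⊹ x) → x ∉ X → f x ∉ image f X
  InjOn-∉ {X = X} {x = x} {f = f} inj x∉X h =
    let z , z∈ , e = ∈-image⁻ {X = X} f h in
    x∉X (subst (_∈ X) (inj (∈⊹ˡ z∈) (∈⊹ʳ {X = X}) e) z∈)

  InjOn-⊹ : ∀ {f : Fin m → Fin m} → InjOn f X → f x ∉ image f X → InjOn f (X ⊹ x)
  InjOn-⊹ {X = X} {x = x} {f = f} inj fx∉ p q e with ∈⊹⁻ p | ∈⊹⁻ q
  ... | inj₁ p′ | inj₁ q′ = inj p′ q′ e
  ... | inj₁ p′ | inj₂ refl = contradiction (subst (_∈ image f X) e (∈-image⁺ f p′)) fx∉
  ... | inj₂ refl | inj₁ q′ = contradiction (subst (_∈ image f X) (sym e) (∈-image⁺ f q′)) fx∉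
  ... | inj₂ refl | inj₂ refl = refl

  ∣image∣ : ∀ (f : Fin m → Fin m) X → InjOn f X → ∣ image f X ∣ ≡ ∣ X ∣
  ∣image∣ f = subset-induction (λ X → InjOn f X → ∣ image f X ∣ ≡ ∣ X ∣)
    (λ _ → cong ∣_∣ (image-⊥ f))
    (λ X x x∉ ih inj → trans (cong ∣_∣ (image-⊹ f X x))
      (trans (∣⊹∣ (InjOn-∉ {X = X} inj x∉)) (trans (cong suc (ih (InjOn-⊹ˡ {X = X} inj))) (sym (∣⊹∣ x∉)))))

  -- One preimage is chosen for each element of `B`. Such a transversal turns `I ∩ S` into
  -- `image f A`, so that the quotient axiom can be applied to `A`.
  image-lift : ∀ (f : Fin m → Fin m) B → B ⊆ image f ⊤ →
    Σ[ A ∈ Subset m ] InjOn f A × image f A ≡ B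
  image-lift f = subset-induction
    (λ B → B ⊆ image f ⊤ → Σ[ A ∈ Subset _ ] InjOn f A × image f A ≡ B)
    (λ _ → ⊥ , (λ p → contradiction p ∉⊥) , image-⊥ f)
    λ B b b∉ ih B⊆ →
      let A , inj , e = ih (λ h → B⊆ (∈⊹ˡ h))
          a , _ , ea = ∈-image⁻ {X = ⊤} f (B⊆ (∈⊹ʳ {X = B}))
          fa∉ = λ h → b∉ (subst₂ _∈_ ea e h)
      in A ⊹ a , InjOn-⊹ inj fa∉ , trans (image-⊹ f A a) (cong₂ _⊹_ e ea)

  -- The fold has the shape of the sum of `f₂` in `induced`, so the two agree by computation. The
  -- list is a parameter because the inductions below run over it.
  weightOver : List (Fin m) → (Fin m → 𝕋) → Subset m → 𝕋
  weightOver xs w B = foldr (λ x acc → if lookup B x then w x ⊙ acc else acc) 𝟘 xs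

  weight : (Fin m → 𝕋) → Subset m → 𝕋
  weight = weightOver (allFin _)

  lookup-⊹-≡ : ∀ (X : Subset m) x → lookup (X ⊹ x) x ≡ true
  lookup-⊹-≡ X x = []=⇒lookup (∈⊹ʳ {X = X})

  lookup-∉ : ∀ (X : Subset m) x → x ∉ X → lookup X x ≡ false
  lookup-∉ X x x∉ with lookup X x in e
  ... | true  = contradiction (lookup⇒[]= x X e) x∉
  ... | false = refl

  lookup-⊹-≢ : ∀ (X : Subset m) {x y} → y ≢ x → lookup (X ⊹ x) y ≡ lookup X y
  lookup-⊹-≢ X {x} {y} y≢x with lookup X y in e
  ... | true  = []=⇒lookup (∈⊹ˡ {X = X} (lookup⇒[]= y X e))
  ... | false = lookup-∉ (X ⊹ x) y (∉⊹ {X = X} (λ h → contradiction (trans (sym e) ([]=⇒lookup h)) λ ()) y≢x)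

  weightOver-∉ : ∀ xs (w : Fin m → 𝕋) X x → All (x ≢_) xs →
    weightOver xs w (X ⊹ x) ≡ weightOver xs w X
  weightOver-∉ [] w X x _ = refl
  weightOver-∉ (y ∷ xs) w X x (x≢y All.∷ h)
    rewrite lookup-⊹-≢ X (x≢y ∘ sym) | weightOver-∉ xs w X x h = refl

  -- Uniqueness of `xs` makes `x` contribute exactly once: past its occurrence, `X` and `X ⊹ x` have
  -- the same sum by `weightOver-∉`.
  weightOver-⊹ : ∀ {xs} (w : Fin m → 𝕋) X {x} → Unique xs → x ∈ᴸ xs → x ∉ X →
    weightOver xs w (X ⊹ x) ≡ w x ⊙ weightOver xs w X
  weightOver-⊹ {xs = x ∷ xs} w X (x≢ ∷ u) (here refl) x∉
    rewrite lookup-⊹-≡ X x | lookup-∉ X x x∉ = cong (w x ⊙_) (weightOver-∉ xs w X x x≢)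
  weightOver-⊹ {xs = y ∷ xs} w X {x} (y≢ ∷ u) (there h) x∉
    rewrite lookup-⊹-≢ X {x} {y} (All.lookup y≢ h) | weightOver-⊹ {xs = xs} w X u h x∉
    with lookup X y
  ... | true  = trans (sym (⊙-assoc (w y) (w x) _))
                  (trans (cong (_⊙ weightOver xs w X) (⊙-comm (w y) (w x))) (⊙-assoc (w x) (w y) _))
  ... | false = refl

  weight-⊹ : ∀ (w : Fin m → 𝕋) X {x} → x ∉ X → weight w (X ⊹ x) ≡ w x ⊙ weight w X
  weight-⊹ w X {x} = weightOver-⊹ w X (allFin⁺ _) (∈ᴸ.∈-allFin x)

  weight-⊥ : ∀ (w : Fin m → 𝕋) → weight w ⊥ ≡ 𝟘
  weight-⊥ w = go (allFin _)
    where
    go : ∀ xs → weightOver xs w ⊥ ≡ 𝟘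
    go [] = refl
    go (x ∷ xs) rewrite lookup-∉ ⊥ x ∉⊥ = go xs

  weight-finite : ∀ (w : Fin m → 𝕋) X → (∀ x → x ∈ X → w x ≢ ∞) → weight w X ≢ ∞
  weight-finite w = subset-induction (λ X → (∀ x → x ∈ X → w x ≢ ∞) → weight w X ≢ ∞)
    (λ _ → subst (_≢ ∞) (sym (weight-⊥ w)) λ ())
    λ X x x∉ ih h → subst (_≢ ∞) (sym (weight-⊹ w X x∉))
      (⊙-finite (h x (∈⊹ʳ {X = X})) (ih λ y y∈ → h y (∈⊹ˡ y∈)))

  admissible : ℕ → Subset m → Subset m → Bool
  admissible k S L = (∣ L ∣ ≡ᵇ k) ∧ not (BL.any (λ x → lookup L x ∧ lookup S x) (allFin _))

  -- The enumeration of subsets is private to Defs; it is recovered as the solution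
  -- of a metavariable once the surrounding functions are abstracted to variables.
  mutual
    subsets : ∀ m → List (Subset m)
    subsets = _

    restriction-def : ∀ m r r′ ν S B → restriction m r r′ ν S B ≡
      ⨁ (map (λ L → ν (B ∪ L)) (filterᵇ (admissible (r ∸ r′) S) (subsets m)))
    restriction-def m r r′ ν S B
      with foldr _⊕_ ∞ | map (λ L → ν (B ∪ L)) | filterᵇ (admissible (r ∸ r′) S)
    ... | minimum | values | admissibles = refl

  ∈-subsets : ∀ (B : Subset m) → B ∈ᴸ subsets m
  ∈-subsets [] = here refl
  ∈-subsets (true  ∷ B) = ∈ᴸ.∈-++⁺ˡ (∈ᴸ.∈-map⁺ (true ∷_) (∈-subsets B))
  ∈-subsets {suc m} (false ∷ B) =
    ∈ᴸ.∈-++⁺ʳ (map (true ∷_) (subsets m)) (∈ᴸ.∈-map⁺ (false ∷_) (∈-subsets B))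

  injectiveᵇ : (Fin m → Fin m) → Subset m → Bool
  injectiveᵇ f B = BL.all (λ x → BL.all (λ y →
    not (lookup B x ∧ lookup B y ∧ ⌊ f x ≟ f y ⌋) ∨ ⌊ x ≟ y ⌋) (allFin _)) (allFin _)

  injectiveᵇ⁺ : ∀ (f : Fin m → Fin m) B → InjOn f B → T (injectiveᵇ f B)
  injectiveᵇ⁺ f B inj = all-allFin⁺ _ λ x → all-allFin⁺ _ λ y → lem x y
    where
    lem : ∀ x y → T (not (lookup B x ∧ lookup B y ∧ ⌊ f x ≟ f y ⌋) ∨ ⌊ x ≟ y ⌋)
    lem x y with lookup B x in ex | lookup B y in ey | f x ≟ f y
    ... | false | _ | _ = _
    ... | true | false | _ = _
    ... | true | true | no _ = _
    ... | true | true | yes e = fromWitness (inj (lookup⇒[]= x B ex) (lookup⇒[]= y B ey) e)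

  injectiveᵇ⁻ : ∀ (f : Fin m → Fin m) B → T (injectiveᵇ f B) → InjOn f B
  injectiveᵇ⁻ f B t {x} {y} p q e
    with all-allFin⁻ _ (all-allFin⁻ _ t x) y
  ... | u rewrite []=⇒lookup p | []=⇒lookup q with f x ≟ f y
  ...   | yes _ = toWitness u
  ...   | no ne = contradiction e ne

  admissible⁺ : ∀ {k} (S L : Subset m) → ∣ L ∣ ≡ k → (∀ {x} → x ∈ L → x ∉ S) → T (admissible k S L)
  admissible⁺ S L refl disj = from T-∧ (ℕₚ.≡⇒≡ᵇ ∣ L ∣ ∣ L ∣ refl , lem)
    where
    lem : T (not (BL.any (λ x → lookup L x ∧ lookup S x) (allFin _)))
    lem with BL.any (λ x → lookup L x ∧ lookup S x) (allFin _) in e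
    ... | false = _
    ... | true  = let x , t = any-allFin⁻ _ (from T-≡ e) ; p , q = to T-∧ t in
                  disj (T⇒∈ {X = L} x p) (T⇒∈ {X = S} x q)

  admissible⁻ : ∀ {k} (S L : Subset m) → T (admissible k S L) → ∣ L ∣ ≡ k × (∀ {x} → x ∈ L → x ∉ S)
  admissible⁻ {k = k} S L t =
    let p , q = to T-∧ t in
    ℕₚ.≡ᵇ⇒≡ ∣ L ∣ k p ,
    λ {x} x∈L x∈S → contradiction
      (to T-≡ (any-allFin⁺ (λ x → lookup L x ∧ lookup S x) x (from T-∧ (∈⇒T x∈L , ∈⇒T x∈S))))
      (λ e → contradiction (trans (sym e) (to T-not-≡ q)) λ ())

  module _ (n r r′ : ℕ) (W : Fin n → Fin n → 𝕋) (ν : Subset n → 𝕋) where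
    private
      f₁ = assocMap₁ W
      f₂ = assocMap₂ W
      S  = image f₁ ⊤
      N  = induced n r r′ W ν
      P  = pointed ν

    -- Together with `induced-attained` this presents `N B` as a minimum over completions when `f₁`
    -- is injective on `B`. The later argument takes just these two facts as hypotheses on an
    -- abstract `N`.
    induced-≤ : ∀ B L → InjOn f₁ B → ∣ L ∣ ≡ r ∸ r′ → (∀ {x} → x ∈ L → x ∉ S) →
      N B ≤T P (image f₁ B ∪ L) ⊙ weight f₂ B
    induced-≤ B L inj ∣L∣ disj with injectiveᵇ f₁ B in e
    ... | false = contradiction (subst T e (injectiveᵇ⁺ f₁ B inj)) λ ()
    ... | true  = ⊙-monoˡ (weight f₂ B) (⨁-≤ _ (∈ᴸ.∈-map⁺ (λ L → P (image f₁ B ∪ L))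
      (∈ᴸ.∈-filter⁺ (T? ∘ admissible (r ∸ r′) S) (∈-subsets L) (admissible⁺ S L ∣L∣ disj))))

    induced-attained : ∀ B → N B ≢ ∞ → InjOn f₁ B ×
      Σ[ L ∈ Subset (suc n) ] ∣ L ∣ ≡ r ∸ r′ × (∀ {x} → x ∈ L → x ∉ S) ×
        N B ≡ P (image f₁ B ∪ L) ⊙ weight f₂ B
    induced-attained B h with injectiveᵇ f₁ B in e
    ... | false = contradiction refl h
    ... | true  =
      let L , L∈ , eq = ∈ᴸ.∈-map⁻ (λ L → P (image f₁ B ∪ L)) (⨁-attained _ (⊙-finiteˡ _ (weight f₂ B) h))
          _ , adm = ∈ᴸ.∈-filter⁻ (T? ∘ admissible (r ∸ r′) S) {xs = subsets (suc n)} L∈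
          ∣L∣ , disj = admissible⁻ S L adm
      in injectiveᵇ⁻ f₁ B (subst T (sym e) _) , L , ∣L∣ , disj , cong (_⊙ weight f₂ B) eq

  -- Exchange

  -- Chaining the two inequalities leaves a common summand `d`, which is finite and cancels. This
  -- carries a comparison of Plücker terms from one set to another whose values of `P` are related
  -- crosswise.
  transfer : ∀ {a b c d w w′ q q′} → d ≢ ∞ → c ⊙ d ≤T a ⊙ b →
    (w′ ⊙ a) ⊙ q′ ≤T (w ⊙ d) ⊙ q → (w′ ⊙ c) ⊙ q′ ≤T (w ⊙ b) ⊙ q
  transfer {a} {b} {c} {d} {w} {w′} {q} {q′} d≢∞ p h =
    subst₂ _≤T_
      (solve 3 (λ c w q → c :⊙ (w :⊙ q) ⊜ (w :⊙ c) :⊙ q) refl c w′ q′)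
      (solve 3 (λ w q b → (w :⊙ q) :⊙ b ⊜ (w :⊙ b) :⊙ q) refl w q b)
      (cross-trans d≢∞ p (subst₂ _≤T_
        (solve 3 (λ w a q → (w :⊙ a) :⊙ q ⊜ a :⊙ (w :⊙ q)) refl w′ a q′)
        (solve 3 (λ w d q → (w :⊙ d) :⊙ q ⊜ (w :⊙ q) :⊙ d) refl w d q)
        h))

  -- The first basis is written `K ⊹ i`, so that `K` is what remains once `i` is removed. The
  -- restriction to finite values lets the axiom pass from `p` to `pointed p`, as it leaves out
  -- every set containing o.
  ValuatedExchange : ∀ {m} → ℕ → (Subset m → 𝕋) → Set
  ValuatedExchange r P = ∀ K Y i → i ∉ K → suc ∣ K ∣ ≡ r → ∣ Y ∣ ≡ r → i ∉ Y →
    P (K ⊹ i) ≢ ∞ → P Y ≢ ∞ → Σ[ j ∈ Fin _ ] j ∈ Y × j ∉ K × j ≢ i ×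
      P (K ⊹ j) ⊙ P ((Y - j) ⊹ i) ≤T P (K ⊹ i) ⊙ P Y

  QuotientExchange : ∀ {m} → ℕ → ℕ → (N Q : Subset m → 𝕋) → Set
  QuotientExchange r t N Q = ∀ A J i → i ∉ A → suc ∣ A ∣ ≡ r → ∣ J ∣ ≡ t → i ∉ J →
    N (A ⊹ i) ≢ ∞ → Q J ≢ ∞ → Σ[ j ∈ Fin _ ] j ∈ J × j ∉ A × j ≢ i ×
      N (A ⊹ j) ⊙ Q ((J ⊹ i) - j) ≤T N (A ⊹ i) ⊙ Q J

  IsQuotient⇒QuotientExchange : ∀ {m r t} (N Q : Subset m → 𝕋) →
    IsQuotient m r t N Q → QuotientExchange r t N Q
  IsQuotient⇒QuotientExchange N Q (_ , ex) A J i i∉A ∣A∣ ∣J∣ i∉J _ _ =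
    let j , j∈J , j∉ , ≤ = ex (A ⊹ i) J (trans (∣⊹∣ i∉A) ∣A∣) ∣J∣ i (∈⊹ʳ {X = A}) i∉J
        e : ((A ⊹ i) ⊹ j) - i ≡ A ⊹ j
        e = trans (cong (_- i) (⊹-comm A i j)) (remove-⊹ (∉⊹ {X = A} i∉A λ i≡j → i∉J (subst (_∈ J) (sym i≡j) j∈J)))
    in j , j∈J , (λ h → j∉ (∈⊹ˡ h)) , (λ j≡i → i∉J (subst (_∈ J) j≡i j∈J)) ,
       subst (λ X → N X ⊙ Q ((J ⊹ i) - j) ≤T N (A ⊹ i) ⊙ Q J) e ≤

  QuotientExchange⇒IsQuotient : ∀ {m r t} (N Q : Subset m → 𝕋) → r ℕ.≤ t →
    QuotientExchange r t N Q → IsQuotient m r t N Q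
  QuotientExchange⇒IsQuotient {m} {r} {t} N Q r≤t ex = r≤t , exchange
    where
    exchange : ∀ I J → ∣ I ∣ ≡ r → ∣ J ∣ ≡ t → ∀ i → i ∈ I → i ∉ J →
      Σ[ j ∈ Fin m ] (j ∈ J × j ∉ I × N ((I ⊹ j) - i) ⊙ Q ((J ⊹ i) - j) ≤T N I ⊙ Q J)
    exchange I J ∣I∣ ∣J∣ i i∈I i∉J with (N I ⊙ Q J) ≟∞
    ... | yes e =
      let j , j∈J , j∉I = exchange-candidate {X = I} {Y = J} (subst₂ ℕ._≤_ (sym ∣I∣) (sym ∣J∣) r≤t) i∈I i∉J
      in j , j∈J , j∉I , ≤T-∞ e
    ... | no ne =
      let restore = ⊹-remove {X = I} i∈I
          j , j∈J , j∉ , j≢i , ≤ = ex (I - i) J i (λ h → ∈-⇒≢ {X = I} h refl) (trans (∣remove∣ i∈I) ∣I∣) ∣J∣ i∉J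
            (subst (λ X → N X ≢ ∞) (sym restore) (⊙-finiteˡ (N I) (Q J) ne)) (⊙-finiteʳ (N I) (Q J) ne)
      in j , j∈J , (λ j∈I → j∉ (x∈p∧x≢y⇒x∈p-y j∈I j≢i)) ,
         subst₂ (λ X Y → N X ⊙ Q ((J ⊹ i) - j) ≤T N Y ⊙ Q J) (sym (⊹-remove-≢ {X = I} j≢i)) restore ≤

  -- Exchanging towards a fixed J, a set of finite value ends up inside J.
  QuotientExchange⇒≤ : ∀ {m r t} (N Q : Subset m → 𝕋) → QuotientExchange r t N Q →
    ∀ I J → ∣ I ∣ ≡ r → ∣ J ∣ ≡ t → N I ≢ ∞ → Q J ≢ ∞ → r ℕ.≤ t
  QuotientExchange⇒≤ {m} {r} {t} N Q ex I J ∣I∣ ∣J∣ NI QJ with r ℕₚ.≤? t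
  ... | yes r≤t = r≤t
  ... | no r≰t = ⊥-elim (go _ I ℕₚ.≤-refl ∣I∣ NI)
    where
    go : ∀ k I → ∣ I ─ J ∣ ℕ.≤ k → ∣ I ∣ ≡ r → N I ≢ ∞ → Empty
    go k I ∣I─J∣ ∣I∣ NI =
      -- As `I` has more elements than `J`, some element of `I` outside `J` is always available, yet
      -- each exchange strictly shrinks `I ─ J`.
      let i , i∈I , i∉J = ∣Y∣<∣X∣⇒∃∈∖ I J (subst₂ ℕ._<_ (sym ∣J∣) (sym ∣I∣) (ℕₚ.≰⇒> r≰t))
          i∉A = λ h → ∈-⇒≢ {X = I} h refl
          restore = ⊹-remove {X = I} i∈I
          ∣A∣ = trans (∣remove∣ i∈I) ∣I∣
          NI′ = subst (λ X → N X ≢ ∞) (sym restore) NI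
          j , j∈J , j∉A , _ , ≤ = ex (I - i) J i i∉A ∣A∣ ∣J∣ i∉J NI′ QJ
          I′ = (I - i) ⊹ j
          ⊂ : ∀ {x} → x ∈ I′ ─ J → x ∈ I - i
          ⊂ = λ h → [ id , (λ x≡j → contradiction (subst (_∈ J) (sym x≡j) j∈J) (∈─⁻ I′ J h)) ]′
                      (∈⊹⁻ {X = I - i} (p─q⊆p I′ J h))
          smaller : ∣ I′ ─ J ∣ ℕ.< ∣ I ─ J ∣
          smaller = p⊂q⇒∣p∣<∣q∣
            ((λ h → x∈p∧x∉q⇒x∈p─q (∈-⇒∈ {X = I} (⊂ h)) (∈─⁻ I′ J h)) ,
             i , x∈p∧x∉q⇒x∈p─q i∈I i∉J , λ h → i∉A (⊂ h))
      in descend k (ℕₚ.<-≤-trans smaller ∣I─J∣) (trans (∣⊹∣ {X = I - i} j∉A) ∣A∣)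
           (⊙-finiteˡ (N I′) _ (≤T-finite ≤ (⊙-finite NI′ QJ)))
      where
      descend : ∀ k {I′} → ∣ I′ ─ J ∣ ℕ.< k → ∣ I′ ∣ ≡ r → N I′ ≢ ∞ → Empty
      -- There is no clause for `zero`, since no cardinality lies below it; this is where the
      -- descent breaks off in a contradiction.
      descend (suc k) (ℕ.s≤s h) = go k _ h

  -- On S the vector s′ ↦ P (I ⊹ s′) is, after adding a constant, at most
  -- s′ ↦ P (I′ ⊹ s′), with equality at s.
  Dominated : ∀ {m} (P : Subset m → 𝕋) (S I I′ : Subset m) → Fin m → Set
  Dominated P S I I′ s = ∀ s′ → s′ ∈ S → s′ ∉ I′ →
    s′ ∉ I × P (I ⊹ s′) ⊙ P (I′ ⊹ s) ≤T P (I′ ⊹ s′) ⊙ P (I ⊹ s)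

  module _ {m r : ℕ} (P : Subset m → 𝕋) (exchange : ValuatedExchange r P) (S : Subset m) where

    -- Exchange `D` against `C` at an `i` in `D ∩ S` outside `C`. If the partner `j` lies outside
    -- `S`, replacing `j` by `i` in `C` is the required move. Otherwise replacing `i` by `j` in `D`
    -- keeps the size of `D ∩ S` and brings `D` closer to `C`.
    augment : ∀ k C D → ∣ D ─ C ∣ ℕ.< k → ∣ C ∣ ≡ r → ∣ D ∣ ≡ r → P C ≢ ∞ → P D ≢ ∞ →
      ∣ C ∩ S ∣ ℕ.< ∣ D ∩ S ∣ →
      Σ[ e ∈ Fin m ] Σ[ b ∈ Fin m ] e ∈ C × e ∉ S × b ∈ S × b ∉ C × P ((C - e) ⊹ b) ≢ ∞
    augment (suc k) C D (ℕ.s≤s ∣D─C∣) ∣C∣ ∣D∣ PC PD ∣C∩S∣ =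
      let i , i∈D∩S , i∉C∩S = ∣Y∣<∣X∣⇒∃∈∖ (D ∩ S) (C ∩ S) ∣C∩S∣
          i∈D , i∈S = x∈p∩q⁻ D S i∈D∩S
          i∉C = λ h → i∉C∩S (x∈p∩q⁺ (h , i∈S))
          i∉K = λ h → ∈-⇒≢ {X = D} h refl
          restore = ⊹-remove {X = D} i∈D
          ∣K∣ = trans (∣remove∣ i∈D) ∣D∣
          PK = subst (λ X → P X ≢ ∞) (sym restore) PD
          j , j∈C , j∉K , j≢i , ≤ = exchange (D - i) C i i∉K ∣K∣ ∣C∣ i∉C PK PC
          ≢∞ = ≤T-finite ≤ (⊙-finite PK PC)
      in result i i∈D i∈S i∉C i∉K ∣K∣ j j∈C j∉K ≢∞ (j ∈? S)
      where
      result : ∀ i → i ∈ D → i ∈ S → i ∉ C → i ∉ D - i → suc ∣ D - i ∣ ≡ r →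
        ∀ j → j ∈ C → j ∉ D - i → P ((D - i) ⊹ j) ⊙ P ((C - j) ⊹ i) ≢ ∞ → Dec (j ∈ S) → _
      result i i∈D i∈S i∉C i∉K ∣K∣ j j∈C j∉K ≢∞ (no j∉S) =
        j , i , j∈C , j∉S , i∈S , i∉C , ⊙-finiteʳ (P ((D - i) ⊹ j)) _ ≢∞
      result i i∈D i∈S i∉C i∉K ∣K∣ j j∈C j∉K ≢∞ (yes j∈S) =
        augment k C D′ (ℕₚ.<-≤-trans smaller ∣D─C∣) ∣C∣ (trans (∣⊹∣ {X = K} j∉K) ∣K∣) PC
          (⊙-finiteˡ (P D′) _ ≢∞) (subst (∣ C ∩ S ∣ ℕ.<_) ∣∩S∣ ∣C∩S∣)
        where
        K  = D - i
        D′ = K ⊹ j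
        ⊂ : ∀ {x} → x ∈ D′ ─ C → x ∈ K
        ⊂ h = [ id , (λ x≡j → contradiction (subst (_∈ C) (sym x≡j) j∈C) (∈─⁻ D′ C h)) ]′
                (∈⊹⁻ {X = K} (p─q⊆p D′ C h))
        smaller : ∣ D′ ─ C ∣ ℕ.< ∣ D ─ C ∣
        smaller = p⊂q⇒∣p∣<∣q∣
          ((λ h → x∈p∧x∉q⇒x∈p─q (∈-⇒∈ {X = D} (⊂ h)) (∈─⁻ D′ C h)) ,
           i , x∈p∧x∉q⇒x∈p─q i∈D i∉C , λ h → i∉K (⊂ h))
        ∣⊹∩S∣ : ∀ {x} → x ∉ K → x ∈ S → ∣ (K ⊹ x) ∩ S ∣ ≡ suc ∣ K ∩ S ∣
        ∣⊹∩S∣ x∉K x∈S = trans (cong ∣_∣ (⊹-∩-∈ {X = K} x∈S)) (∣⊹∣ {X = K ∩ S} (x∉K ∘ proj₁ ∘ x∈p∩q⁻ K S))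
        ∣∩S∣ : ∣ D ∩ S ∣ ≡ ∣ D′ ∩ S ∣
        ∣∩S∣ = trans (cong (λ X → ∣ X ∩ S ∣) (sym (⊹-remove {X = D} i∈D)))
                 (trans (∣⊹∩S∣ i∉K i∈S) (sym (∣⊹∩S∣ j∉K j∈S)))

    module Dominate {r′ : ℕ} (D : Subset m) (∣D∣ : ∣ D ∣ ≡ r) (PD : P D ≢ ∞) (∣D∩S∣ : ∣ D ∩ S ∣ ≡ r′)
        (s : Fin m) (s∈S : s ∈ S) where

      dominate-step : ∀ I → suc ∣ I ∣ ≡ r → s ∉ I → P (I ⊹ s) ≢ ∞ → ∣ (I ⊹ s) ∩ S ∣ ℕ.< r′ →
        Σ[ I′ ∈ Subset m ] suc ∣ I′ ∣ ≡ r × s ∉ I′ × P (I′ ⊹ s) ≢ ∞ ×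
          ∣ (I′ ⊹ s) ∩ S ∣ ≡ suc ∣ (I ⊹ s) ∩ S ∣ × Dominated P S I I′ s
      dominate-step I ∣I∣ s∉I PI ∣I∩S∣ =
        let e , b , e∈ , e∉S , b∈S , b∉ , Pb = augment _ (I ⊹ s) D ℕₚ.≤-refl
              (trans (∣⊹∣ {X = I} s∉I) ∣I∣) ∣D∣ PI PD (subst (∣ (I ⊹ s) ∩ S ∣ ℕ.<_) (sym ∣D∩S∣) ∣I∩S∣)
            e≢s = λ e≡s → e∉S (subst (_∈ S) (sym e≡s) s∈S)
        in replace e (∈⊹-≢ {X = I} e∈ e≢s) e∉S e≢s b b∈S b∉ Pb
        where
        module _ (e : Fin m) (e∈I : e ∈ I) (e∉S : e ∉ S) (e≢s : e ≢ s)
                 (b : Fin m) (b∈S : b ∈ S) (b∉ : b ∉ I ⊹ s) (Pb : P (((I ⊹ s) - e) ⊹ b) ≢ ∞) where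
          K = I - e

          swap : ∀ x → ((I ⊹ s) - e) ⊹ x ≡ (K ⊹ x) ⊹ s
          swap x = trans (cong (_⊹ x) (⊹-remove-≢ {X = I} (e≢s ∘ sym))) (⊹-comm K s x)

          Candidate : Fin m → Set
          Candidate x = x ∈ S × x ∉ I × x ≢ s × P ((K ⊹ x) ⊹ s) ≢ ∞

          -- Crosswise form of P(K ∪ x ∪ s) - P(I ∪ x) ≤ P(K ∪ y ∪ s) - P(I ∪ y).
          _≲_ : Fin m → Fin m → Set
          x ≲ y = P ((K ⊹ x) ⊹ s) ⊙ P (I ⊹ y) ≤T P ((K ⊹ y) ⊹ s) ⊙ P (I ⊹ x)

          -- A candidate `y` with `P (I ⊹ y)` infinite ranks as -∞. Because `P ((K ⊹ y) ⊹ s)` is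
          -- finite, anything below such a `y` ranks as -∞ too and so lies below every `z`.
          ≲-trans : ∀ {x y z} → Candidate x → Candidate y → Candidate z → x ≲ y → y ≲ z → x ≲ z
          ≲-trans {x} {y} {z} _ (_ , _ , _ , Py) _ p q with P (I ⊹ y) ≟∞
          ... | no ≢∞ = cross-trans ≢∞ p q
          ... | yes inf with P (I ⊹ x) ≟∞
          ...   | yes inf′ = ≤T-∞ (trans (cong (P ((K ⊹ z) ⊹ s) ⊙_) inf′) (⊙-∞ʳ _))
          ...   | no ≢∞′ = contradiction
                    (trans (cong (P ((K ⊹ x) ⊹ s) ⊙_) inf) (⊙-∞ʳ _))
                    (≤T-finite p (⊙-finite Py ≢∞′))

          replace : Σ[ I′ ∈ Subset m ] suc ∣ I′ ∣ ≡ r × s ∉ I′ × P (I′ ⊹ s) ≢ ∞ ×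
            ∣ (I′ ⊹ s) ∩ S ∣ ≡ suc ∣ (I ⊹ s) ∩ S ∣ × Dominated P S I I′ s
          replace with extremum
            (λ x → (x ∈? S) ×-dec (¬? (x ∈? I)) ×-dec (¬? (x ≟ s)) ×-dec (¬? (P ((K ⊹ x) ⊹ s) ≟∞)))
            _≲_ (λ x y → ≤T-total _ _) ≲-trans (allFin m)
          -- The element `b` supplied by `augment` shows that there is something to minimise over.
          ... | inj₁ none = contradiction
            (b∈S , (λ h → b∉ (∈⊹ˡ h)) , (λ b≡s → b∉ (subst (_∈ I ⊹ s) (sym b≡s) (∈⊹ʳ {X = I})))
              , subst (λ X → P X ≢ ∞) (swap b) Pb)
            (none b (∈ᴸ.∈-allFin b))
          ... | inj₂ (c , (c∈S , c∉I , c≢s , Pc) , least) =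
            K ⊹ c , trans (cong suc ∣Kc∣) ∣I∣ , s∉Kc , Pc , ∣∩S∣ , dominated
            where
            c∉K : c ∉ K
            c∉K h = c∉I (∈-⇒∈ {X = I} h)
            ∣Kc∣ : ∣ K ⊹ c ∣ ≡ ∣ I ∣
            ∣Kc∣ = trans (∣⊹∣ {X = K} c∉K) (∣remove∣ e∈I)
            s∉Kc : s ∉ K ⊹ c
            s∉Kc = ∉⊹ {X = K} (λ h → s∉I (∈-⇒∈ {X = I} h)) (c≢s ∘ sym)
            c∉Is : c ∉ I ⊹ s
            c∉Is = ∉⊹ {X = I} c∉I c≢s
            ∣∩S∣ : ∣ ((K ⊹ c) ⊹ s) ∩ S ∣ ≡ suc ∣ (I ⊹ s) ∩ S ∣
            ∣∩S∣ = trans (cong (λ X → ∣ X ∩ S ∣) (sym (swap c)))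
              (trans (cong ∣_∣ (trans (⊹-∩-∈ {X = (I ⊹ s) - e} c∈S) (cong (_⊹ c) (remove-∩-∉ {X = I ⊹ s} e∉S))))
                (∣⊹∣ {X = (I ⊹ s) ∩ S} (c∉Is ∘ proj₁ ∘ x∈p∩q⁻ (I ⊹ s) S)))
            dominated : Dominated P S I (K ⊹ c) s
            dominated s′ s′∈S s′∉ = s′∉I , bound (s′ ≟ s) (P ((K ⊹ c) ⊹ s′) ≟∞)
              where
              s′∉I : s′ ∉ I
              s′∉I h = s′∉ (∈⊹ˡ {X = K} (x∈p∧x≢y⇒x∈p-y h λ s′≡e → e∉S (subst (_∈ S) s′≡e s′∈S)))
              s′∉K : s′ ∉ K
              s′∉K h = s′∉I (∈-⇒∈ {X = I} h)
              c≢s′ : c ≢ s′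
              c≢s′ c≡s′ = s′∉ (subst (_∈ K ⊹ c) c≡s′ (∈⊹ʳ {X = K}))
              bound : Dec (s′ ≡ s) → Dec (P ((K ⊹ c) ⊹ s′) ≡ ∞) →
                P (I ⊹ s′) ⊙ P ((K ⊹ c) ⊹ s) ≤T P ((K ⊹ c) ⊹ s′) ⊙ P (I ⊹ s)
              bound (yes refl) _ = ≤T-reflexive (⊙-comm _ _)
              bound (no _) (yes inf) = ≤T-∞ (cong (_⊙ P (I ⊹ s)) inf)
              -- Removing `c` from `(K ⊹ s′) ⊹ c` against `I ⊹ s` leaves only `s` and `e` as
              -- partners, since every other element of `I ⊹ s` lies in `K`.
              bound (no s′≢s) (no ≢∞) = from-exchange (exchange (K ⊹ s′) (I ⊹ s) c
                (∉⊹ {X = K} c∉K c≢s′) (trans (cong suc (trans (∣⊹∣ {X = K} s′∉K) (∣remove∣ e∈I))) ∣I∣)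
                (trans (∣⊹∣ {X = I} s∉I) ∣I∣) c∉Is ≢∞′ PI)
                where
                ≢∞′ : P ((K ⊹ s′) ⊹ c) ≢ ∞
                ≢∞′ = subst (λ X → P X ≢ ∞) (⊹-comm K c s′) ≢∞
                from-exchange : (Σ[ j ∈ Fin m ] j ∈ I ⊹ s × j ∉ K ⊹ s′ × j ≢ c ×
                    P ((K ⊹ s′) ⊹ j) ⊙ P (((I ⊹ s) - j) ⊹ c) ≤T P ((K ⊹ s′) ⊹ c) ⊙ P (I ⊹ s)) →
                  P (I ⊹ s′) ⊙ P ((K ⊹ c) ⊹ s) ≤T P ((K ⊹ c) ⊹ s′) ⊙ P (I ⊹ s)
                from-exchange (j , j∈ , j∉ , j≢c , ≤) with j ≟ s
                -- For the partner `s`, minimality of `c` is applied to `s′`. The exchange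
                -- inequality itself keeps `P ((K ⊹ s′) ⊹ s)` finite, so `s′` is a candidate.
                ... | yes refl = ≤T-trans
                  (subst (_≤T P ((K ⊹ s′) ⊹ s) ⊙ P (I ⊹ c)) (⊙-comm (P ((K ⊹ c) ⊹ s)) _)
                    (least s′ (∈ᴸ.∈-allFin s′)
                    (s′∈S , s′∉I , s′≢s ,
                      ⊙-finiteˡ (P ((K ⊹ s′) ⊹ s)) _ (≤T-finite ≤ (⊙-finite ≢∞′ PI)))))
                  (subst₂ (λ X Y → P ((K ⊹ s′) ⊹ s) ⊙ P (X ⊹ c) ≤T P Y ⊙ P (I ⊹ s))
                    (remove-⊹ {X = I} s∉I) (⊹-comm K s′ c) ≤)
                ... | no j≢s with j ≟ e
                ...   | no j≢e = contradiction (∈⊹ˡ {X = K} (x∈p∧x≢y⇒x∈p-y (∈⊹-≢ {X = I} j∈ j≢s) j≢e)) j∉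
                -- For the partner `e`, putting `e` back into `K` restores `I`, and the exchange
                -- inequality is already the bound.
                ...   | yes refl = subst₂ _≤T_
                  (cong₂ (λ X Y → P X ⊙ P Y)
                    (trans (⊹-comm K s′ e) (cong (_⊹ s′) (⊹-remove {X = I} e∈I))) (swap c))
                  (cong (λ X → P X ⊙ P (I ⊹ s)) (⊹-comm K s′ c)) ≤

      -- `k` counts how many elements of `S` are still missing. Dominations compose because
      -- `P (I₁ ⊹ s)` is finite and can be cancelled.
      dominate : ∀ k I → ∣ (I ⊹ s) ∩ S ∣ ℕ.+ k ≡ r′ → suc ∣ I ∣ ≡ r → s ∉ I → P (I ⊹ s) ≢ ∞ →
        Σ[ I′ ∈ Subset m ] suc ∣ I′ ∣ ≡ r × s ∉ I′ × P (I′ ⊹ s) ≢ ∞ ×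
          ∣ (I′ ⊹ s) ∩ S ∣ ≡ r′ × Dominated P S I I′ s
      dominate zero I ∣I∩S∣ ∣I∣ s∉I PI = I , ∣I∣ , s∉I , PI , trans (sym (ℕₚ.+-identityʳ _)) ∣I∩S∣ ,
        λ s′ _ s′∉ → s′∉ , ≤T-refl
      dominate (suc k) I ∣I∩S∣ ∣I∣ s∉I PI =
        let I₁ , ∣I₁∣ , s∉I₁ , PI₁ , ∣I₁∩S∣ , dom₁ = dominate-step I ∣I∣ s∉I PI
              (subst (∣ (I ⊹ s) ∩ S ∣ ℕ.<_) ∣I∩S∣ (ℕₚ.m<m+n _ ℕ.z<s))
            I₂ , ∣I₂∣ , s∉I₂ , PI₂ , ∣I₂∩S∣ , dom₂ = dominate k I₁
              (trans (cong (ℕ._+ k) ∣I₁∩S∣) (trans (sym (ℕₚ.+-suc _ k)) ∣I∩S∣)) ∣I₁∣ s∉I₁ PI₁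
        in I₂ , ∣I₂∣ , s∉I₂ , PI₂ , ∣I₂∩S∣ , λ s′ s′∈S s′∉I₂ →
             let s′∉I₁ , p₂ = dom₂ s′ s′∈S s′∉I₂
                 s′∉I , p₁ = dom₁ s′ s′∈S s′∉I₁
             in s′∉I , cross-trans PI₁ p₁ p₂

  -- The values of P at I ⊹ s and I ⊹ s′ differ by a constant independent of the
  -- part of I outside S, as long as the part X inside S has corank one in S.
  restriction-exchange : ∀ {m r r′} (P : Subset m → 𝕋) → ValuatedExchange r P → ∀ S →
    (∀ C → ∣ C ∣ ≡ r → P C ≢ ∞ → ∣ C ∩ S ∣ ℕ.≤ r′) →
    ∀ X I L s s′ → X ⊆ I → X ⊆ S → suc ∣ X ∣ ≡ r′ → suc ∣ I ∣ ≡ r → suc ∣ X ∪ L ∣ ≡ r →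
    (∀ {x} → x ∈ L → x ∉ S) → s ∈ S → s′ ∈ S → s ∉ I → s′ ∉ X →
    P (I ⊹ s) ≢ ∞ → P ((X ∪ L) ⊹ s′) ≢ ∞ →
    P (I ⊹ s′) ⊙ P ((X ∪ L) ⊹ s) ≤T P ((X ∪ L) ⊹ s′) ⊙ P (I ⊹ s)
  restriction-exchange {m} {r} {r′} P exchange S ∣∩S∣≤ X I L s s′ X⊆I X⊆S ∣X∣ ∣I∣ ∣I′∣ disj
    s∈S s′∈S s∉I s′∉X PI PI′ =
    cross (s ≟ s′)
    where
    I′ = X ∪ L
    Goal = P (I ⊹ s′) ⊙ P (I′ ⊹ s) ≤T P (I′ ⊹ s′) ⊙ P (I ⊹ s)
    ∉I′ : ∀ {x} → x ∈ S → x ∉ X → x ∉ I′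
    ∉I′ x∈S x∉X h = [ x∉X , (λ k → disj k x∈S) ]′ (x∈p∪q⁻ X L h)
    s∉X : s ∉ X
    s∉X = s∉I ∘ X⊆I
    s′∉I′ : s′ ∉ I′
    s′∉I′ = ∉I′ s′∈S s′∉X

    module _ (s≢s′ : s ≢ s′) where
      s∉I′s′ : s ∉ I′ ⊹ s′
      s∉I′s′ = ∉⊹ {X = I′} (∉I′ s∈S s∉X) s≢s′

      -- A partner `x` other than `s′` would belong to `L`, hence lie outside `S`. Then `Z` would
      -- keep `X`, `s′` and `s`, which are r′ + 1 elements of `S`, against the rank bound.
      module _ (x : Fin m) (x∈ : x ∈ I′ ⊹ s′) (x∉I : x ∉ I) (x≢s′ : x ≢ s′)
               (PZ : P (((I′ ⊹ s′) - x) ⊹ s) ≢ ∞) where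
        Z = ((I′ ⊹ s′) - x) ⊹ s
        x∉S : x ∉ S
        x∉S = [ (λ h → contradiction (X⊆I h) x∉I) , disj ]′ (x∈p∪q⁻ X L (∈⊹-≢ {X = I′} x∈ x≢s′))
        ∣Z∣ : ∣ Z ∣ ≡ r
        ∣Z∣ = trans (∣⊹∣ {X = (I′ ⊹ s′) - x} (s∉I′s′ ∘ ∈-⇒∈ {X = I′ ⊹ s′}))
          (trans (∣remove∣ x∈) (trans (∣⊹∣ {X = I′} s′∉I′) ∣I′∣))
        Xs′⊆S : ∀ {y} → y ∈ X ⊹ s′ → y ∈ S
        Xs′⊆S h = [ X⊆S , (λ e → subst (_∈ S) (sym e) s′∈S) ]′ (∈⊹⁻ {X = X} h)
        Xs′⊆I′s′ : ∀ {y} → y ∈ X ⊹ s′ → y ∈ I′ ⊹ s′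
        Xs′⊆I′s′ h = [ (λ k → ∈⊹ˡ {X = I′} (x∈p∪q⁺ (inj₁ k)))
                     , (λ e → subst (_∈ I′ ⊹ s′) (sym e) (∈⊹ʳ {X = I′})) ]′ (∈⊹⁻ {X = X} h)
        Xs′s⊆Z∩S : X ⊹ s′ ⊹ s ⊆ Z ∩ S
        Xs′s⊆Z∩S h = [ (λ k → x∈p∩q⁺ (∈⊹ˡ {X = (I′ ⊹ s′) - x} (x∈p∧x≢y⇒x∈p-y (Xs′⊆I′s′ k)
                                  λ y≡x → x∉S (subst (_∈ S) y≡x (Xs′⊆S k))) , Xs′⊆S k))
                     , (λ e → x∈p∩q⁺ (subst (_∈ Z) (sym e) (∈⊹ʳ {X = (I′ ⊹ s′) - x})
                                     , subst (_∈ S) (sym e) s∈S)) ]′ (∈⊹⁻ {X = X ⊹ s′} h)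
        rank-exceeded : r′ ℕ.< ∣ Z ∩ S ∣
        rank-exceeded = subst (ℕ._≤ ∣ Z ∩ S ∣)
          (trans (∣⊹∣ {X = X ⊹ s′} (∉⊹ {X = X} s∉X s≢s′)) (cong suc (trans (∣⊹∣ {X = X} s′∉X) ∣X∣)))
          (p⊆q⇒∣p∣≤∣q∣ Xs′s⊆Z∩S)
        impossible : Goal
        impossible = contradiction (∣∩S∣≤ Z ∣Z∣ PZ) (ℕₚ.<⇒≱ rank-exceeded)

    cross : Dec (s ≡ s′) → Goal
    cross (yes e) = ≤T-reflexive (trans (⊙-comm (P (I ⊹ s′)) _)
      (cong₂ (λ x y → P (I′ ⊹ x) ⊙ P (I ⊹ y)) e (sym e)))
    cross (no s≢s′) with exchange I (I′ ⊹ s′) s s∉I ∣I∣ (trans (∣⊹∣ {X = I′} s′∉I′) ∣I′∣) (s∉I′s′ s≢s′) PI PI′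
    ... | x , x∈ , x∉I , x≢s , ≤ with x ≟ s′
    ...   | yes refl = subst₂ (λ Z v → P (I ⊹ s′) ⊙ P (Z ⊹ s) ≤T v) (remove-⊹ {X = I′} s′∉I′)
                         (⊙-comm (P (I ⊹ s)) _) ≤
    ...   | no x≢s′ = impossible s≢s′ x x∈ x∉I x≢s′
                        (⊙-finiteʳ (P (I ⊹ x)) _ (≤T-finite ≤ (⊙-finite PI PI′)))

  -- Plücker relations and quotients

  plückerTerm : ∀ {m} (f : Fin m → Fin m) (w : Fin m → 𝕋) (P Q : Subset m → 𝕋) →
    (I J : Subset m) → Fin m → 𝕋
  plückerTerm f w P Q I J i = (w i ⊙ P (I ⊹ f i)) ⊙ Q (J - i)

  -- Attaining the minimum twice, in the form of an exchange axiom: a given `i` is answered by some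
  -- `j`. At a finite minimal term the answer is a second minimiser; conversely, of two minimisers
  -- at least one differs from `i`.
  PlückerRelations : ∀ {m} → ℕ → ℕ → (Fin m → Fin m) → (Fin m → 𝕋) → (P Q : Subset m → 𝕋) → Set
  PlückerRelations r t f w P Q =
    ∀ I J i → suc ∣ I ∣ ≡ r → ∣ J ∣ ≡ suc t → i ∈ J → f i ∉ I → term I J i ≢ ∞ →
    Σ[ j ∈ Fin _ ] j ∈ J × j ≢ i × f j ∉ I × term I J j ≤T term I J i
    where term = plückerTerm f w P Q

  -- `loops` records that an infinite weight occurs only at elements sent to a loop. Hence a
  -- transversal of part of a finite basis has finite weight, which can be cancelled.
  module _ {m r r′ t : ℕ} (f : Fin m → Fin m) (w : Fin m → 𝕋) (P Q N : Subset m → 𝕋)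
    (loops : ∀ i C → w i ≡ ∞ → f i ∈ C → P C ≡ ∞)
    (r′≤r : r′ ℕ.≤ r)
    (N-≤ : ∀ B L → InjOn f B → ∣ L ∣ ≡ r ∸ r′ → (∀ {x} → x ∈ L → x ∉ image f ⊤) →
      N B ≤T P (image f B ∪ L) ⊙ weight w B)
    (N-attained : ∀ B → N B ≢ ∞ → InjOn f B × Σ[ L ∈ Subset m ] ∣ L ∣ ≡ r ∸ r′ ×
      (∀ {x} → x ∈ L → x ∉ image f ⊤) × N B ≡ P (image f B ∪ L) ⊙ weight w B)
    where

    private
      S    = image f ⊤
      term = plückerTerm f w P Q

    term-value : ∀ A L i J → i ∉ A →
      (P (image f (A ⊹ i) ∪ L) ⊙ weight w (A ⊹ i)) ⊙ Q (J - i) ≡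
      term (image f A ∪ L) J i ⊙ weight w A
    term-value A L i J i∉A = trans
      (cong₂ (λ X v → (P X ⊙ v) ⊙ Q (J - i))
        (trans (cong (_∪ L) (image-⊹ f A i)) (sym (⊹-∪ (image f A) L (f i))))
        (weight-⊹ w A i∉A))
      (solve 4 (λ p x y q → (p :⊙ (x :⊙ y)) :⊙ q ⊜ ((x :⊙ p) :⊙ q) :⊙ y) refl
        (P ((image f A ∪ L) ⊹ f i)) (w i) (weight w A) (Q (J - i)))

    ∣image∪∣ : ∀ A L → InjOn f A → ∣ L ∣ ≡ r ∸ r′ → (∀ {x} → x ∈ L → x ∉ S) →
      suc ∣ A ∣ ≡ r′ → suc ∣ image f A ∪ L ∣ ≡ r
    ∣image∪∣ A L inj ∣L∣ disj ∣A∣ = trans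
      (cong suc (trans (∣∪∣ {X = image f A} {L = L} λ p q → disj q (image-⊆ f A p))
        (cong₂ ℕ._+_ (∣image∣ f A inj) ∣L∣)))
      (trans (cong (ℕ._+ (r ∸ r′)) ∣A∣) (ℕₚ.m+[n∸m]≡n r′≤r))

    fi∈S : ∀ i → f i ∈ S
    fi∈S i = ∈-image⁺ {X = ⊤} f ∈⊤

    ∉-image∪ : ∀ {A L i} → f i ∉ image f A → (∀ {x} → x ∈ L → x ∉ S) → f i ∉ image f A ∪ L
    ∉-image∪ {A} {L} {i} ∉A disj h with x∈p∪q⁻ (image f A) L h
    ... | inj₁ p = ∉A p
    ... | inj₂ q = disj q (fi∈S i)

    Plücker⇒Quotient : PlückerRelations r t f w P Q → QuotientExchange r′ t N Q
    Plücker⇒Quotient plücker A J i i∉A ∣A∣ ∣J∣ i∉J NA QJ with N-attained (A ⊹ i) NA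
    ... | inj , L , ∣L∣ , disj , N≡ = conclude (plücker I (J ⊹ i) i (∣image∪∣ A L injA ∣L∣ disj ∣A∣)
            (trans (∣⊹∣ {X = J} i∉J) (cong suc ∣J∣)) (∈⊹ʳ {X = J})
            (∉-image∪ {A} {L} (InjOn-∉ {X = A} inj i∉A) disj)
            (⊙-finiteˡ (term I (J ⊹ i) i) (weight w A) (subst (_≢ ∞) start (⊙-finite NA QJ))))
      where
      I = image f A ∪ L
      injA : InjOn f A
      injA = InjOn-⊹ˡ {X = A} inj
      start : N (A ⊹ i) ⊙ Q J ≡ term I (J ⊹ i) i ⊙ weight w A
      start = trans (cong₂ _⊙_ N≡ (cong Q (sym (remove-⊹ {X = J} i∉J)))) (term-value A L i (J ⊹ i) i∉A)
      conclude : (Σ[ j ∈ Fin m ] j ∈ J ⊹ i × j ≢ i × f j ∉ I × term I (J ⊹ i) j ≤T term I (J ⊹ i) i) →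
        Σ[ j ∈ Fin m ] j ∈ J × j ∉ A × j ≢ i × N (A ⊹ j) ⊙ Q ((J ⊹ i) - j) ≤T N (A ⊹ i) ⊙ Q J
      conclude (j , j∈J⁺ , j≢i , fj∉I , ≤) = j , ∈⊹-≢ {X = J} j∈J⁺ j≢i , j∉A , j≢i ,
        -- `L` attains the value of `N` at `A ⊹ i`. At `A ⊹ j` it is merely one competitor in the
        -- minimum, which gives the inequality in the needed direction.
        ≤T-trans (⊙-monoˡ (Q ((J ⊹ i) - j)) (N-≤ (A ⊹ j) L (InjOn-⊹ {X = A} injA fj∉A) ∣L∣ disj))
          (subst₂ _≤T_ (sym (term-value A L j (J ⊹ i) j∉A)) (sym start) (⊙-monoˡ (weight w A) ≤))
        where
        fj∉A : f j ∉ image f A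
        fj∉A h = fj∉I (x∈p∪q⁺ (inj₁ h))
        j∉A : j ∉ A
        j∉A h = fj∉A (∈-image⁺ f h)

    module _ (exchange : ValuatedExchange r P)
      (D : Subset m) (∣D∣ : ∣ D ∣ ≡ r) (PD : P D ≢ ∞) (∣D∩S∣ : ∣ D ∩ S ∣ ≡ r′)
      (∣∩S∣≤ : ∀ C → ∣ C ∣ ≡ r → P C ≢ ∞ → ∣ C ∩ S ∣ ℕ.≤ r′)
      where

      module _ (quotient : QuotientExchange r′ t N Q) where

        -- The quotient inequality is first read with the completion `L′` that attains `N (A ⊹ j)`.
        -- `restriction-exchange` then converts it into one for `I` itself.
        spanning-relation : ∀ I J i → suc ∣ I ∣ ≡ r → ∣ J ∣ ≡ suc t → i ∈ J → f i ∉ I →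
          ∣ (I ⊹ f i) ∩ S ∣ ≡ r′ → term I J i ≢ ∞ →
          Σ[ j ∈ Fin m ] j ∈ J × j ≢ i × f j ∉ I × term I J j ≤T term I J i
        spanning-relation I J i ∣I∣ ∣J∣ i∈J s∉I ∣Is∩S∣ tm =
          let A , injA , fA≡ = image-lift f (I ∩ S) (λ h → proj₂ (x∈p∩q⁻ I S h))
          in relate A injA fA≡
          where
          module _ (A : Subset m) (injA : InjOn f A) (fA≡ : image f A ≡ I ∩ S) where
            s = f i
            L = I ─ S
            wP = ⊙-finiteˡ (w i ⊙ P (I ⊹ s)) (Q (J - i)) tm
            wi = ⊙-finiteˡ (w i) (P (I ⊹ s)) wP
            PI = ⊙-finiteʳ (w i) (P (I ⊹ s)) wP
            QJ = ⊙-finiteʳ (w i ⊙ P (I ⊹ s)) (Q (J - i)) tm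
            I≡ : image f A ∪ L ≡ I
            I≡ = trans (cong (_∪ L) fA≡) (∩∪─ I S)
            ∈fA : ∀ {x} → x ∈ I → x ∈ S → x ∈ image f A
            ∈fA p q = subst (_ ∈_) (sym fA≡) (x∈p∩q⁺ (p , q))
            fA⊆I : ∀ {x} → x ∈ image f A → x ∈ I
            fA⊆I h = proj₁ (x∈p∩q⁻ I S (subst (_ ∈_) fA≡ h))
            s∉fA : s ∉ image f A
            s∉fA h = s∉I (fA⊆I h)
            i∉A : i ∉ A
            i∉A h = s∉fA (∈-image⁺ f h)
            ∣A∣ : suc ∣ A ∣ ≡ r′
            ∣A∣ = trans (cong suc (trans (sym (∣image∣ f A injA)) (cong ∣_∣ fA≡)))
              (trans (sym (∣⊹∣ {X = I ∩ S} (s∉I ∘ proj₁ ∘ x∈p∩q⁻ I S)))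
                (trans (cong ∣_∣ (sym (⊹-∩-∈ {X = I} (fi∈S i)))) ∣Is∩S∣))
            ∣L∣ : ∣ L ∣ ≡ r ∸ r′
            ∣L∣ = sym (trans (cong₂ _∸_ (trans (sym ∣I∣) (cong suc (trans (sym (∣∩∣+∣─∣ I S))
              (cong (ℕ._+ ∣ L ∣) (trans (cong ∣_∣ (sym fA≡)) (∣image∣ f A injA)))))) (sym ∣A∣)) (ℕₚ.m+n∸m≡n ∣ A ∣ ∣ L ∣))
            ω : weight w A ≢ ∞
            ω = weight-finite w A λ x x∈A wx → PI (loops x (I ⊹ s) wx (∈⊹ˡ {X = I} (fA⊆I (∈-image⁺ f x∈A))))
            -- Used twice: the completion `I ─ S` shows that `N (A ⊹ i)` is finite, and the
            -- completion attaining `N (A ⊹ j)` yields the comparison of terms.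
            bound : ∀ L′ → ∣ L′ ∣ ≡ r ∸ r′ → (∀ {x} → x ∈ L′ → x ∉ S) →
              N (A ⊹ i) ⊙ Q (J - i) ≤T term (image f A ∪ L′) J i ⊙ weight w A
            bound L′ ∣L′∣ disj = subst (N (A ⊹ i) ⊙ Q (J - i) ≤T_) (term-value A L′ i J i∉A)
              (⊙-monoˡ (Q (J - i)) (N-≤ (A ⊹ i) L′ (InjOn-⊹ {X = A} injA s∉fA) ∣L′∣ disj))
            NA : N (A ⊹ i) ≢ ∞
            NA = ⊙-finiteˡ _ (Q (J - i)) (≤T-finite (bound L ∣L∣ (∈─⁻ I S))
              (⊙-finite (subst (λ X → term X J i ≢ ∞) (sym I≡) tm) ω))

            close : ∀ j → j ∈ J → j ∉ A → j ≢ i → N (A ⊹ j) ⊙ Q (((J - i) ⊹ i) - j) ≢ ∞ →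
              N (A ⊹ j) ⊙ Q (J - j) ≤T N (A ⊹ i) ⊙ Q (J - i) →
              Σ[ j ∈ Fin m ] j ∈ J × j ≢ i × f j ∉ I × term I J j ≤T term I J i
            close j j∈J j∉A j≢i NQ ≤ =
              let inj , L′ , ∣L′∣ , disj , N≡ = N-attained (A ⊹ j) (⊙-finiteˡ (N (A ⊹ j)) _ NQ)
              in close′ inj L′ ∣L′∣ disj N≡
              where
              close′ : InjOn f (A ⊹ j) → ∀ L′ → ∣ L′ ∣ ≡ r ∸ r′ → (∀ {x} → x ∈ L′ → x ∉ S) →
                N (A ⊹ j) ≡ P (image f (A ⊹ j) ∪ L′) ⊙ weight w (A ⊹ j) →
                Σ[ j ∈ Fin m ] j ∈ J × j ≢ i × f j ∉ I × term I J j ≤T term I J i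
              close′ inj L′ ∣L′∣ disj N≡ = j , j∈J , j≢i , s′∉I , transfer Pd crossing comparison
                where
                s′ = f j
                I′ = image f A ∪ L′
                s′∉fA : s′ ∉ image f A
                s′∉fA = InjOn-∉ {X = A} inj j∉A
                s′∉I : s′ ∉ I
                s′∉I h = s′∉fA (∈fA h (fi∈S j))
                s∉I′ : s ∉ I′
                s∉I′ = ∉-image∪ {A} {L′} s∉fA disj
                s′∉I′ : s′ ∉ I′
                s′∉I′ = ∉-image∪ {A} {L′} s′∉fA disj
                ∣I′∣ : suc ∣ I′ ∣ ≡ r
                ∣I′∣ = ∣image∪∣ A L′ injA ∣L′∣ disj ∣A∣
                PI′ : P (I′ ⊹ s′) ≢ ∞
                PI′ = subst (λ X → P X ≢ ∞) (trans (cong (_∪ L′) (image-⊹ f A j)) (sym (⊹-∪ (image f A) L′ s′)))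
                  (⊙-finiteˡ _ (weight w (A ⊹ j)) (subst (_≢ ∞) N≡ (⊙-finiteˡ (N (A ⊹ j)) _ NQ)))
                comparison : (w j ⊙ P (I′ ⊹ s′)) ⊙ Q (J - j) ≤T (w i ⊙ P (I′ ⊹ s)) ⊙ Q (J - i)
                comparison = ⊙-cancelʳ ω (≤T-trans (≤T-reflexive
                  (trans (sym (term-value A L′ j J j∉A)) (cong (_⊙ Q (J - j)) (sym N≡))))
                  (≤T-trans ≤ (bound L′ ∣L′∣ disj)))
                crossing : P (I ⊹ s′) ⊙ P (I′ ⊹ s) ≤T P (I′ ⊹ s′) ⊙ P (I ⊹ s)
                crossing = restriction-exchange P exchange S ∣∩S∣≤ (image f A) I L′ s s′ fA⊆I (image-⊆ f A)
                  (trans (cong suc (∣image∣ f A injA)) ∣A∣) ∣I∣ ∣I′∣ disj (fi∈S i) (fi∈S j) s∉I s′∉fA PI PI′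
                -- The summand to be cancelled is finite because `crossing` bounds a sum containing
                -- it by a finite value.
                Pd : P (I′ ⊹ s) ≢ ∞
                Pd = ⊙-finiteʳ (P (I ⊹ s′)) _ (≤T-finite crossing (⊙-finite PI′ PI))

            relate : Σ[ j ∈ Fin m ] j ∈ J × j ≢ i × f j ∉ I × term I J j ≤T term I J i
            relate with quotient A (J - i) i i∉A ∣A∣
              (ℕₚ.suc-injective (trans (∣remove∣ i∈J) ∣J∣)) (λ h → ∈-⇒≢ {X = J} h refl) NA QJ
            ... | j , j∈J⁻ , j∉A , j≢i , ≤ = close j (∈-⇒∈ {X = J} j∈J⁻) j∉A j≢i
              (≤T-finite ≤ (⊙-finite NA QJ))
              (subst (λ X → N (A ⊹ j) ⊙ Q (X - j) ≤T N (A ⊹ i) ⊙ Q (J - i)) (⊹-remove {X = J} i∈J) ≤)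

        Quotient⇒Plücker : PlückerRelations r t f w P Q
        Quotient⇒Plücker I J i ∣I∣ ∣J∣ i∈J s∉I tm = compare
          (Dominate.dominate P exchange S D ∣D∣ PD ∣D∩S∣ (f i) (fi∈S i) (r′ ∸ ∣ (I ⊹ f i) ∩ S ∣) I
            (ℕₚ.m+[n∸m]≡n (∣∩S∣≤ (I ⊹ f i) (trans (∣⊹∣ {X = I} s∉I) ∣I∣) PI)) ∣I∣ s∉I PI)
          where
          wP : w i ⊙ P (I ⊹ f i) ≢ ∞
          wP = ⊙-finiteˡ _ (Q (J - i)) tm
          PI : P (I ⊹ f i) ≢ ∞
          PI = ⊙-finiteʳ (w i) _ wP
          compare : (Σ[ I′ ∈ Subset m ] suc ∣ I′ ∣ ≡ r × f i ∉ I′ × P (I′ ⊹ f i) ≢ ∞ ×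
              ∣ (I′ ⊹ f i) ∩ S ∣ ≡ r′ × Dominated P S I I′ (f i)) →
            Σ[ j ∈ Fin m ] j ∈ J × j ≢ i × f j ∉ I × term I J j ≤T term I J i
          compare (I′ , ∣I′∣ , s∉I′ , PI′ , ∣I′s∩S∣ , dominated) = choose
            (spanning-relation I′ J i ∣I′∣ ∣J∣ i∈J s∉I′ ∣I′s∩S∣
              (⊙-finite (⊙-finite (⊙-finiteˡ (w i) (P (I ⊹ f i)) wP) PI′)
                (⊙-finiteʳ (w i ⊙ P (I ⊹ f i)) (Q (J - i)) tm)))
            where
            choose : (Σ[ j ∈ Fin m ] j ∈ J × j ≢ i × f j ∉ I′ × term I′ J j ≤T term I′ J i) →
              Σ[ j ∈ Fin m ] j ∈ J × j ≢ i × f j ∉ I × term I J j ≤T term I J i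
            choose (j , j∈J , j≢i , s′∉I′ , ≤) =
              j , j∈J , j≢i , proj₁ (dominated (f j) (fi∈S j) s′∉I′) ,
              transfer PI′ (proj₂ (dominated (f j) (fi∈S j) s′∉I′)) ≤

      -- `D ∩ S` lifts to `A`, and `D ─ S` is a completion of the right size. The resulting finite
      -- value of `N` is the starting point of the descent that proves r′ ≤ t.
      finite-basis : Σ[ A ∈ Subset m ] ∣ A ∣ ≡ r′ × N A ≢ ∞
      finite-basis with image-lift f (D ∩ S) (λ h → proj₂ (x∈p∩q⁻ D S h))
      ... | A , inj , fA≡ = A , trans (sym (∣image∣ f A inj)) (trans (cong ∣_∣ fA≡) ∣D∩S∣) ,
        ≤T-finite (N-≤ A (D ─ S) inj ∣L∣ (∈─⁻ D S)) (⊙-finite (subst (λ X → P X ≢ ∞) (sym D≡) PD) ω)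
        where
        D≡ : image f A ∪ (D ─ S) ≡ D
        D≡ = trans (cong (_∪ (D ─ S)) fA≡) (∩∪─ D S)
        ∣L∣ : ∣ D ─ S ∣ ≡ r ∸ r′
        ∣L∣ = sym (trans (cong₂ _∸_ (trans (sym ∣D∣) (sym (∣∩∣+∣─∣ D S))) (sym ∣D∩S∣))
          (ℕₚ.m+n∸m≡n ∣ D ∩ S ∣ ∣ D ─ S ∣))
        ω : weight w A ≢ ∞
        ω = weight-finite w A λ x x∈A wx → PD (loops x D wx
          (proj₁ (x∈p∩q⁻ D S (subst (f x ∈_) fA≡ (∈-image⁺ f x∈A)))))

      Plücker⇒IsQuotient : (Σ[ B ∈ Subset m ] ∣ B ∣ ≡ t × Q B ≢ ∞) →
        PlückerRelations r t f w P Q → IsQuotient m r′ t N Q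
      Plücker⇒IsQuotient (B , ∣B∣ , QB) plücker = QuotientExchange⇒IsQuotient N Q
        (let A , ∣A∣ , NA = finite-basis in QuotientExchange⇒≤ N Q quotient A B ∣A∣ ∣B∣ NA QB) quotient
        where
        quotient = Plücker⇒Quotient plücker

      IsQuotient⇒Plücker : IsQuotient m r′ t N Q → PlückerRelations r t f w P Q
      IsQuotient⇒Plücker = Quotient⇒Plücker ∘ IsQuotient⇒QuotientExchange N Q

  -- The map associated to a weakly monomial matrix

  -- The literal `∞` in front lets the search take a step that is stuck on a variable row, so the
  -- two sides of `image-of-row-cong` already differ at the search.
  prepend∞ : ∀ {n} → (Fin n → 𝕋) → Fin (suc n) → 𝕋
  prepend∞ v zero = ∞
  prepend∞ v (suc i) = v i

  -- The search inside assocMap₁ is private to Defs.  The metavariables below are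
  -- solved by unification: abstracting W i makes the row an independent argument, and
  -- cong! then isolates the search because both sides differ only there.
  mutual
    firstFinite : ∀ n → (Fin (suc n) → 𝕋) → Maybe (Fin (suc n))
    firstFinite = _

    image-of-row : ∀ n → (Fin (suc n) → Fin (suc n) → 𝕋) → Fin (suc n) → (Fin (suc n) → 𝕋) → Fin (suc (suc n))
    image-of-row = _

    assocMap₁-row : ∀ n W i → assocMap₁ W (suc i) ≡ image-of-row n W i (W i)
    assocMap₁-row n W i with W i
    ... | v = refl

    image-of-row-cong : ∀ n W i v v′ → (∀ v v′ → firstFinite n v ≡ firstFinite n v′) →
      image-of-row n W i v ≡ image-of-row n W i (prepend∞ v′)
    image-of-row-cong n W i v v′ e with tt
    ... | tt = cong! (e v (prepend∞ v′))

  firstFinite-spec : ∀ n v → (Σ[ j ∈ Fin (suc n) ] firstFinite n v ≡ just j × v j ≢ ∞) ⊎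
                             (firstFinite n v ≡ nothing × (∀ j → v j ≡ ∞))
  firstFinite-spec n v with v zero in e
  ... | fin x = inj₁ (zero , refl , λ e′ → contradiction (trans (sym e) e′) λ ())
  firstFinite-spec zero v | ∞ = inj₂ (refl , λ { zero → e })
  firstFinite-spec (suc n) v | ∞ with firstFinite n (v ∘ suc) | firstFinite-spec n (v ∘ suc)
  ... | just j  | inj₁ (_ , refl , vj) = inj₁ (suc j , refl , vj)
  ... | nothing | inj₂ (_ , v≡∞) = inj₂ (refl , λ { zero → e ; (suc j) → v≡∞ j })
  ... | just _  | inj₂ (() , _)
  ... | nothing | inj₁ (_ , () , _)

  assocMap-spec : ∀ {n} (W : Fin n → Fin n → 𝕋) i →
    (Σ[ j ∈ Fin n ] W i j ≢ ∞ × assocMap₁ W (suc i) ≡ suc j × assocMap₂ W (suc i) ≡ W i j) ⊎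
    ((∀ j → W i j ≡ ∞) × assocMap₁ W (suc i) ≡ zero × assocMap₂ W (suc i) ≡ ∞)
  assocMap-spec {suc n} W i with firstFinite n (W i) | firstFinite-spec n (W i)
  ... | just j  | inj₁ (_ , refl , Wij) = inj₁ (j , Wij , refl , refl)
  ... | nothing | inj₂ (_ , W≡∞) = inj₂ (W≡∞ , refl , refl)
  ... | just _  | inj₂ (() , _)
  ... | nothing | inj₁ (_ , () , _)

  -- Pointed valuated matroids, ranks and tropical Plücker relations

  allPairs : ∀ n → List (Fin n × Fin n)
  allPairs n = cartesianProduct (allFin n) (allFin n)

  ∈-allPairs : ∀ {n} x → x ∈ᴸ allPairs n
  ∈-allPairs (i , j) = ∈ᴸ.∈-cartesianProduct⁺ (∈ᴸ.∈-allFin i) (∈ᴸ.∈-allFin j)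

  pointed-∞ : ∀ {n} (p : Subset n → 𝕋) {C} → zero ∈ C → pointed p C ≡ ∞
  pointed-∞ p here = refl

  pointed-exchange : ∀ {n r} {p : Subset n → 𝕋} → IsValuatedMatroid n r p → ValuatedExchange r (pointed p)
  pointed-exchange vm (true ∷ K) Y zero _ _ _ _ PK _ = contradiction refl PK
  pointed-exchange vm (true ∷ K) Y (suc i) _ _ _ _ PK _ = contradiction refl PK
  pointed-exchange vm (false ∷ K) Y zero _ _ _ _ PK _ = contradiction refl PK
  pointed-exchange vm (false ∷ K) (true ∷ Y) (suc i) _ _ _ _ _ PY = contradiction refl PY
  pointed-exchange {p = p} vm (false ∷ K) (false ∷ Y) (suc i) i∉K ∣K∣ ∣Y∣ i∉Y _ _ =
    let i∉K′ = λ h → i∉K (there h)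
        j , j∈Y , j∉ , ≤ = proj₂ vm (K ⊹ i) Y (trans (∣⊹∣ {X = K} i∉K′) ∣K∣) ∣Y∣ i (∈⊹ʳ {X = K}) (λ h → i∉Y (there h))
    in suc j , there j∈Y , (λ { (there h) → j∉ (∈⊹ˡ {X = K} h) }) ,
       (λ e → i∉Y (subst (_∈ false ∷ Y) e (there j∈Y))) ,
       subst (λ X → p (X ⊹ j) ⊙ p ((Y - j) ⊹ i) ≤T p (K ⊹ i) ⊙ p Y) (remove-⊹ {X = K} i∉K′) ≤

  -- For a minimal term `j`, exchanging `j` between `I ⊹ j` and `J - j` gives another index `k`
  -- whose term is no larger, hence also minimal.
  valuated⇒TropGP : ∀ {n d p} → IsValuatedMatroid n d p → TropGP n d p
  valuated⇒TropGP {n} {d} {p} (_ , exchange) I J ∣I∣ ∣J∣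
    with extremum (λ j → (j ∈? J) ×-dec (¬? (j ∈? I))) (λ x y → t x ≤T t y)
           (λ _ _ → ≤T-total _ _) (λ _ _ _ → ≤T-trans) (allFin n)
    where
    t : Fin n → 𝕋
    t j = p (I ⊹ j) ⊙ p (J - j)
  ... | inj₁ none = inj₁ λ j h → contradiction h (none j (∈ᴸ.∈-allFin j))
  ... | inj₂ (j , (j∈J , j∉I) , least)
    with exchange (I ⊹ j) (J - j) (trans (∣⊹∣ {X = I} j∉I) ∣I∣)
           (ℕₚ.suc-injective (trans (∣remove∣ j∈J) ∣J∣)) j (∈⊹ʳ {X = I}) (λ h → ∈-⇒≢ {X = J} h refl)
  ... | k , k∈ , k∉ , ≤ = inj₂ (j , k , (j∈J , j∉I) , k-valid , j≢k ,
          ≤T-antisym (least k (∈ᴸ.∈-allFin k) k-valid)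
            (subst₂ (λ X Y → p (X ⊹ k) ⊙ p Y ≤T p (I ⊹ j) ⊙ p (J - j)) (remove-⊹ {X = I} j∉I)
              (trans (cong (_⊹ j) (p─x─y≡p─y─x J j k)) (⊹-remove {X = J - k} (x∈p∧x≢y⇒x∈p-y j∈J j≢k))) ≤) ,
          λ z h → least z (∈ᴸ.∈-allFin z) h)
    where
    k-valid = ∈-⇒∈ {X = J} k∈ , λ h → k∉ (∈⊹ˡ {X = I} h)
    j≢k : j ≢ k
    j≢k j≡k = k∉ (subst (_∈ I ⊹ j) j≡k (∈⊹ʳ {X = I}))

  module _ {m r : ℕ} (P : Subset m → 𝕋) (S : Subset m) where

    -- `IsAffineMorphism` speaks of every r′ that is the rank of `S`, so using it requires such a
    -- number. It is the largest size of `C ∩ S` over sets `C` of finite value.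
    rank-exists : (Σ[ B ∈ Subset m ] ∣ B ∣ ≡ r × P B ≢ ∞) → Σ[ r′ ∈ ℕ ] IsRank m r P S r′
    rank-exists (B , ∣B∣ , PB)
      with extremum (λ C → (∣ C ∣ ℕₚ.≟ r) ×-dec (¬? (P C ≟∞))) (λ C D → ∣ D ∩ S ∣ ℕ.≤ ∣ C ∩ S ∣)
             (λ _ _ → ℕₚ.≤-total _ _) (λ _ _ _ p q → ℕₚ.≤-trans q p) (subsets m)
    ... | inj₁ none = contradiction (∣B∣ , PB) (none B (∈-subsets B))
    ... | inj₂ (C , (∣C∣ , PC) , largest) = ∣ C ∩ S ∣ ,
      (C ∩ S , p∩q⊆q C S , refl , C , ∣C∣ , p∩q⊆p C S , PC) ,
      λ { B B⊆S (D , ∣D∣ , B⊆D , PD) → ℕₚ.≤-trans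
            (p⊆q⇒∣p∣≤∣q∣ λ h → x∈p∩q⁺ (B⊆D h , B⊆S h)) (largest D (∈-subsets D) (∣D∣ , PD)) }

    module _ {r′ : ℕ} (rank : IsRank m r P S r′) where

      ∣∩S∣≤rank : ∀ C → ∣ C ∣ ≡ r → P C ≢ ∞ → ∣ C ∩ S ∣ ℕ.≤ r′
      ∣∩S∣≤rank C ∣C∣ PC = proj₂ rank (C ∩ S) (p∩q⊆q C S) (C , ∣C∣ , p∩q⊆p C S , PC)

      rank-attained : Σ[ D ∈ Subset m ] ∣ D ∣ ≡ r × P D ≢ ∞ × ∣ D ∩ S ∣ ≡ r′
      rank-attained = let (B , B⊆S , ∣B∣ , D , ∣D∣ , B⊆D , PD) , _ = rank in
        D , ∣D∣ , PD , ℕₚ.≤-antisym (∣∩S∣≤rank D ∣D∣ PD)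
          (subst (ℕ._≤ ∣ D ∩ S ∣) ∣B∣ (p⊆q⇒∣p∣≤∣q∣ λ h → x∈p∩q⁺ (B⊆D h , B⊆S h)))

      rank≤ : r′ ℕ.≤ r
      rank≤ = let (B , _ , ∣B∣ , D , ∣D∣ , B⊆D , _) , _ = rank in
        subst₂ ℕ._≤_ ∣B∣ ∣D∣ (p⊆q⇒∣p∣≤∣q∣ B⊆D)

  module _ {n : ℕ} (W : Fin n → Fin n → 𝕋) (monomial : ∀ i j j′ → W i j ≢ ∞ → W i j′ ≢ ∞ → j ≡ j′) where
    private
      f₁ = assocMap₁ W
      f₂ = assocMap₂ W

    assocMap-entry : ∀ i j → W i j ≢ ∞ → f₁ (suc i) ≡ suc j × f₂ (suc i) ≡ W i j
    assocMap-entry i j Wij with assocMap-spec W i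
    ... | inj₁ (j′ , Wij′ , e₁ , e₂) with monomial i j j′ Wij Wij′
    ...   | refl = e₁ , e₂
    assocMap-entry i j Wij | inj₂ (W≡∞ , _) = contradiction (W≡∞ j) Wij

    assocMap-finite : ∀ i → f₂ (suc i) ≢ ∞ → Σ[ j ∈ Fin n ] f₁ (suc i) ≡ suc j × f₂ (suc i) ≡ W i j
    assocMap-finite i wi with assocMap-spec W i
    ... | inj₁ (j , _ , e₁ , e₂) = j , e₁ , e₂
    ... | inj₂ (_ , _ , e) = contradiction e wi

    assocMap-∞ : ∀ i → f₂ i ≡ ∞ → f₁ i ≡ zero
    assocMap-∞ zero _ = refl
    assocMap-∞ (suc i) wi with assocMap-spec W i
    ... | inj₁ (j , Wij , _ , e) = contradiction (trans (sym e) wi) Wij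
    ... | inj₂ (_ , e , _) = e

    assocMap-loops : ∀ (p : Subset n → 𝕋) i C → f₂ i ≡ ∞ → f₁ i ∈ C → pointed p C ≡ ∞
    assocMap-loops p i C wi fi∈C = pointed-∞ p (subst (_∈ C) (assocMap-∞ i wi) fi∈C)

    module _ (p q : Subset n → 𝕋) where
      private
        term = plückerTerm f₁ f₂ (pointed p) (pointed q)

      entryTerm : (I J : Subset n) → Fin n × Fin n → 𝕋
      entryTerm I J (i , j) = W i j ⊙ p (I ⊹ j) ⊙ q (J - i)

      term≡entryTerm : ∀ I J {i j} → f₁ (suc i) ≡ suc j → f₂ (suc i) ≡ W i j →
        term (false ∷ I) (false ∷ J) (suc i) ≡ entryTerm I J (i , j)
      term≡entryTerm I J e₁ e₂ rewrite e₁ | e₂ = refl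

      entry-finite : ∀ I J {i j} → entryTerm I J (i , j) ≢ ∞ → W i j ≢ ∞
      entry-finite I J {i} {j} h = ⊙-finiteˡ (W i j) _ (⊙-finiteˡ _ (q (J - i)) h)

      TropQP⇒Plücker : ∀ {r t} → TropQP n r t W p q → PlückerRelations r t f₁ f₂ (pointed p) (pointed q)
      TropQP⇒Plücker qp I J zero _ _ _ _ h = contradiction refl h
      TropQP⇒Plücker qp I J (suc i) ∣I∣ ∣J∣ i∈J fi∉I h
        with assocMap-finite i (⊙-finiteˡ (f₂ (suc i)) _ (⊙-finiteˡ _ (pointed q (J - suc i)) h))
      TropQP⇒Plücker qp (true ∷ I) J (suc i) ∣I∣ ∣J∣ i∈J fi∉I h | j , e₁ , e₂ =
        contradiction (pointed-∞ p (∈⊹ˡ {X = true ∷ I} {y = f₁ (suc i)} here))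
          (⊙-finiteʳ (f₂ (suc i)) _ (⊙-finiteˡ _ (pointed q (J - suc i)) h))
      TropQP⇒Plücker qp (false ∷ I) (true ∷ J) (suc i) ∣I∣ ∣J∣ i∈J fi∉I h | j , e₁ , e₂ =
        contradiction refl (⊙-finiteʳ (f₂ (suc i) ⊙ pointed p ((false ∷ I) ⊹ f₁ (suc i))) _ h)
      TropQP⇒Plücker qp (false ∷ I) (false ∷ J) (suc i) ∣I∣ ∣J∣ (there i∈J) fi∉I h | j , e₁ , e₂ =
        conclude (qp I J ∣I∣ ∣J∣)
        where
        T≡ = term≡entryTerm I J e₁ e₂
        finite : entryTerm I J (i , j) ≢ ∞
        finite = subst (_≢ ∞) T≡ h
        j∉I : j ∉ I
        j∉I k = fi∉I (subst (_∈ false ∷ I) (sym e₁) (there k))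
        -- A term below a finite one has a finite matrix entry, so its column is the one chosen by
        -- `f₁`. A different pair must then lie in a different row, as each row has one finite
        -- entry.
        other : ∀ y → (proj₂ y ∉ I × proj₁ y ∈ J) → (i , j) ≢ y → entryTerm I J y ≤T entryTerm I J (i , j) → _
        other (i′ , j′) (j′∉I , i′∈J) ne ≤ =
          let Wij′ = entry-finite I J (≤T-finite ≤ finite)
              e₁′ , e₂′ = assocMap-entry i′ j′ Wij′
          in suc i′ , there i′∈J ,
             (λ { refl → ne (cong (i ,_) (monomial i j j′ (entry-finite I J finite) Wij′)) }) ,
             (λ k → j′∉I (drop-there (subst (_∈ false ∷ I) e₁′ k))) ,
             subst₂ _≤T_ (sym (term≡entryTerm I J e₁′ e₂′)) (sym T≡) ≤
        conclude : MinTwice (λ ij → proj₂ ij ∉ I × proj₁ ij ∈ J) (entryTerm I J) → _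
        conclude (inj₁ all∞) = contradiction (all∞ (i , j) (j∉I , i∈J)) finite
        conclude (inj₂ (x , y , Px , Py , x≢y , tx≡ty , least)) with ≡-dec _≟_ _≟_ (i , j) x
        ... | no ne = other x Px ne (least (i , j) (j∉I , i∈J))
        ... | yes refl = other y Py x≢y (≤T-reflexive (sym tx≡ty))

      Plücker⇒TropQP : ∀ {r t} → PlückerRelations r t f₁ f₂ (pointed p) (pointed q) → TropQP n r t W p q
      Plücker⇒TropQP plücker I J ∣I∣ ∣J∣
        with extremum (λ ij → (¬? (proj₂ ij ∈? I)) ×-dec (proj₁ ij ∈? J))
               (λ x y → entryTerm I J x ≤T entryTerm I J y) (λ _ _ → ≤T-total _ _) (λ _ _ _ → ≤T-trans)
               (allPairs n)
      ... | inj₁ none = inj₁ λ x Px → contradiction Px (none x (∈-allPairs x))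
      ... | inj₂ ((i , j) , Px , least) with entryTerm I J (i , j) ≟∞
      -- An infinite minimum makes every term infinite, the first alternative of `MinTwice`.
      ...   | yes inf = inj₁ λ x Px → ≤T-antisym (_ ≤∞) (subst (_≤T entryTerm I J x) inf (least x (∈-allPairs x) Px))
      ...   | no finite = conclude (plücker (false ∷ I) (false ∷ J) (suc i) ∣I∣ ∣J∣ (there (proj₂ Px))
                (λ k → proj₁ Px (drop-there (subst (_∈ false ∷ I) (proj₁ entry) k))) (subst (_≢ ∞) (sym T≡) finite))
        where
        entry = assocMap-entry i j (entry-finite I J finite)
        T≡ = term≡entryTerm I J (proj₁ entry) (proj₂ entry)
        conclude : Σ[ k ∈ Fin (suc n) ] k ∈ false ∷ J × k ≢ suc i × f₁ k ∉ false ∷ I ×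
            term (false ∷ I) (false ∷ J) k ≤T term (false ∷ I) (false ∷ J) (suc i) →
          MinTwice (λ ij → proj₂ ij ∉ I × proj₁ ij ∈ J) (entryTerm I J)
        conclude (suc i′ , there i′∈J , i′≢i , fi′∉I , ≤)
          with assocMap-finite i′ (⊙-finiteˡ (f₂ (suc i′)) _ (⊙-finiteˡ _ (q (J - i′))
                 (≤T-finite ≤ (subst (_≢ ∞) (sym T≡) finite))))
        ... | j′ , e₁ , e₂ = inj₂ ((i , j) , (i′ , j′) , Px , Py , (λ { refl → i′≢i refl }) ,
              ≤T-antisym (least _ (∈-allPairs _) Py) (subst₂ _≤T_ (term≡entryTerm I J e₁ e₂) T≡ ≤) ,
              λ z Pz → least z (∈-allPairs z) Pz)
          where
          Py = (λ k → fi′∉I (subst (_∈ false ∷ I) (sym e₁) (there k))) , i′∈J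

      module _ {r t : ℕ} (p-valuated : IsValuatedMatroid n r p) where

        TropQP⇒IsAffineMorphism : IsValuatedMatroid n t q → TropQP n r t W p q → IsAffineMorphism n t r W q p
        TropQP⇒IsAffineMorphism ((B , ∣B∣ , qB) , _) qp r′ rank = result (rank-attained P S rank)
          where
          P = pointed p
          S = image f₁ ⊤
          result : (Σ[ D ∈ Subset (suc n) ] ∣ D ∣ ≡ r × P D ≢ ∞ × ∣ D ∩ S ∣ ≡ r′) →
            IsQuotient (suc n) r′ t (induced n r r′ W p) (pointed q)
          result (D , ∣D∣ , PD , ∣D∩S∣) =
            Plücker⇒IsQuotient f₁ f₂ P (pointed q) (induced n r r′ W p) (assocMap-loops p)
              (rank≤ P S rank) (induced-≤ n r r′ W p) (induced-attained n r r′ W p)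
              (pointed-exchange p-valuated) D ∣D∣ PD ∣D∩S∣ (∣∩S∣≤rank P S rank)
              (false ∷ B , ∣B∣ , qB) (TropQP⇒Plücker qp)

        IsAffineMorphism⇒TropQP : IsAffineMorphism n t r W q p → TropQP n r t W p q
        IsAffineMorphism⇒TropQP affine = result (rank-exists P S (basis (proj₁ p-valuated)))
          where
          P = pointed p
          S = image f₁ ⊤
          basis : (Σ[ B ∈ Subset n ] ∣ B ∣ ≡ r × p B ≢ ∞) → Σ[ B ∈ Subset (suc n) ] ∣ B ∣ ≡ r × P B ≢ ∞
          basis (B , ∣B∣ , pB) = false ∷ B , ∣B∣ , pB
          result : (Σ[ r′ ∈ ℕ ] IsRank (suc n) r P S r′) → TropQP n r t W p q
          result (r′ , rank) = Plücker⇒TropQP (relations (rank-attained P S rank))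
            where
            relations : (Σ[ D ∈ Subset (suc n) ] ∣ D ∣ ≡ r × P D ≢ ∞ × ∣ D ∩ S ∣ ≡ r′) →
              PlückerRelations r t f₁ f₂ P (pointed q)
            relations (D , ∣D∣ , PD , ∣D∩S∣) =
              IsQuotient⇒Plücker f₁ f₂ P (pointed q) (induced n r r′ W p) (assocMap-loops p)
                (rank≤ P S rank) (induced-≤ n r r′ W p) (induced-attained n r r′ W p)
                (pointed-exchange p-valuated) D ∣D∣ PD ∣D∩S∣ (∣∩S∣≤rank P S rank) (affine r′ rank)

theoremB : (ℝ : Reals) {c ℓ : Level} (K : Field c ℓ) (v : Trop.Valuation ℝ K)
    (n k a : ℕ) (s t : Fin a → Fin k)
    (A : Fin a → Fin n → Fin n → Field.Carrier K) →
    (∀ α → Trop.WeaklyMonomial ℝ K (A α)) →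
    (d : Fin k → ℕ) (μ : Fin k → Subset n → Trop.𝕋 ℝ) →
    (∀ i → Trop.IsValuatedMatroid ℝ n (d i) (μ i)) →
    let W : Fin a → Fin n → Fin n → Trop.𝕋 ℝ
        W α i j = Trop.Valuation.val v (A α i j)
    in (Trop.InQDr ℝ n k a s t W d μ →
    ∀ α → Trop.IsAffineMorphism ℝ n (d (t α)) (d (s α)) (W α) (μ (t α)) (μ (s α)))
    × ((∀ α → Trop.IsAffineMorphism ℝ n (d (t α)) (d (s α)) (W α) (μ (t α)) (μ (s α))) →
    Trop.InQDr ℝ n k a s t W d μ)
theoremB ℝ K v n k a s t A weaklyMonomial d μ valuated =
  (λ (_ , qp) α → TropQP⇒IsAffineMorphism (W α) (monomial α) (μ (s α)) (μ (t α))
                    (valuated (s α)) (valuated (t α)) (qp α)) ,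
  λ affine → (λ i → valuated⇒TropGP (valuated i)) ,
    λ α → IsAffineMorphism⇒TropQP (W α) (monomial α) (μ (s α)) (μ (t α)) (valuated (s α)) (affine α)
  where
  open Trop ℝ
  open Theory ℝ
  open Valuation v
  W : Fin a → Fin n → Fin n → 𝕋
  W α i j = val (A α i j)
  monomial : ∀ α i j j′ → W α i j ≢ ∞ → W α i j′ ≢ ∞ → j ≡ j′
  monomial α i j j′ p q = weaklyMonomial α i j j′ (p ∘ proj₂ (val-∞ (A α i j))) (q ∘ proj₂ (val-∞ (A α i j′)))
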